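{- Let $k$ be a positive integer, $i\in\{3,5,7\}$, and $p$ a prime with $p\equiv i\pmod 8$. Let $\delta$ be a non-negative integer such that $p$ divides $8\delta+i$. Then for every non-negative integer $n$, $\mathcal{J}_6(N_1)$ and $\mathcal{J}_6(N_2)$ have the same parity, where \[ N_1=3p\left(8p^k n+8\delta+i\right),\qquad N_2=24\left(p^{k-1}n+\frac{8\delta+i-p}{8p}\right)+3. \]
   Context: Let $q=e^{2\pi i\tau}$ with $\tau$ in the upper half-plane, and let $\eta(\tau)=q^{1/24}\prod_{n\ge1}(1-q^n)$ be the Dedekind eta function. The Hauptmodul of $\Gamma_0(6)$ is \[ j_6(\tau)=\left(\frac{\eta(2\tau)\eta(3\tau)^3}{\eta(\tau)\eta(6\tau)^3}\right)^3-3=\frac1q+\sum_{n\ge1}\mathcal{J}_6(n)q^n, \] and $\mathcal{J}_6(n)$ denotes its $n$-th Fourier coefficient (an integer). -}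

module Defs where

open import Data.Nat as ℕ using (ℕ; zero; suc; _∸_; _≤ᵇ_; NonZero)
open import Data.Nat.DivMod using (_/_)
open import Data.Nat.Primality using (Prime; prime⇒nonZero)
open import Data.Nat.Properties using (m*n≢0)
open import Data.Integer using (ℤ; +_; _+_; _-_)
open import Data.List using (List; upTo; map; foldr)
open import Data.Bool using (if_then_else_)

Series : Set
Series = ℕ → ℤ

one : Series
one zero    = + 1
one (suc _) = + 0

mul1m : ℕ → Series → Series
mul1m m f N = if m ≤ᵇ N then f N - f (N ∸ m) else f N

-- multiplication by (1 - q^(suc m))^(-1) = Σ_{k ≥ 0} q^(k (suc m))
div1m : ℕ → Series → Series
div1m m f N =
  foldr _+_ (+ 0)
    (map (λ k → if (k ℕ.* suc m) ≤ᵇ N then f (N ∸ k ℕ.* suc m) else + 0)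
         (upTo (suc N)))

iter : ℕ → (Series → Series) → Series → Series
iter zero    g f = f
iter (suc r) g f = g (iter r g f)

-- multiplication by the m-th factor (m = suc m'):
--   (1-q^{2m})^3 (1-q^{3m})^9 / ((1-q^m)^3 (1-q^{6m})^9)
-- which is the m-th factor of (η(2τ)η(3τ)^3/(η(τ)η(6τ)^3))^3 · q
factor : ℕ → Series → Series
factor m' f =
  let m = suc m' in
  iter 3 (mul1m (2 ℕ.* m)) (iter 9 (mul1m (3 ℕ.* m))
    (iter 3 (div1m m') (iter 9 (div1m (6 ℕ.* m ∸ 1)) f)))

partialProd : ℕ → Series → Series
partialProd zero    f = f
partialProd (suc M) f = factor M (partialProd M f)

-- F(q) = q (j_6(τ) + 3) = Π_{m≥1} factor_m ; coefficient of q^N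
-- (factors with m > N do not affect the coefficient of q^N)
Fcoef : ℕ → ℤ
Fcoef N = partialProd N one N

-- J6 n = n-th Fourier coefficient of j_6 = 1/q + Σ_{n≥1} J6(n) q^n
-- (index 0 gives the constant term, which is 0)
J6 : ℕ → ℤ
J6 zero    = Fcoef 1 - + 3
J6 (suc n) = Fcoef (suc (suc n))

N₂ : (k i p δ n : ℕ) → Prime p → ℕ
N₂ k i p δ n pp =
  let instance _ = prime⇒nonZero pp
               _ = m*n≢0 8 p
  in 24 ℕ.* (p ℕ.^ (k ∸ 1) ℕ.* n ℕ.+ (8 ℕ.* δ ℕ.+ i ∸ p) / (8 ℕ.* p)) ℕ.+ 3

module Submission where

-- Modulo 2, write f = ∏ (1 − qᵐ), ψ = ∑ q^(n(n+1)/2), and let indices denote substitution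
-- (f₃ = f(q³)); squaring is f ↦ f₂. Then q (j₆ + 3) ≡ f³ / f₃⁹. Gauss' theorem gives f³ ≡ ψ,
-- and splitting the triangular numbers modulo 3 together with Euler's pentagonal number
-- theorem gives f³ ≡ f₃ + q f₉³. By this relation the series D = f³ f₃³ + f¹² + q f₃¹²
-- satisfies D(q) = q D(q³), so D ≡ 0, that is f³ f₃³ ≡ f¹² + q f₃¹². Dissecting f³ / f₃⁹
-- by these identities, once modulo 3 and three times modulo 2, one finds that
-- J6 (3 (8r + 1)) ≡ [q^r] ψ, so it is odd exactly when 8r + 1 is a square. In the theorem
-- N₁ = 3 p² (8r + 1) and N₂ = 3 (8r + 1), and p² (8r + 1) is a square iff 8r + 1 is.

open import Defs
open import Data.Nat using (ℕ; _+_; _*_; _^_; _≤_; _%_)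
open import Data.Nat.Divisibility using (_∣_)
open import Data.Nat.Primality using (Prime)
open import Data.Integer using (_-_)
open import Data.Integer.Divisibility renaming (_∣_ to _∣ℤ_)
open import Data.Integer using (+_)
open import Data.Sum using (_⊎_)
open import Relation.Binary.PropositionalEquality using (_≡_)

open import Algebra.Bundles using (CommutativeRing)
import Algebra.Properties.CommutativeSemigroup as CommutativeSemigroupProperties
import Algebra.Properties.CommutativeSemiring.Exp as CommutativeExp
import Algebra.Properties.Semiring.Exp as Exp
import Algebra.Solver.Ring as RingSolver
open import Algebra.Solver.Ring.AlmostCommutativeRing
  using (fromCommutativeRing; _-Raw-AlmostCommutative⟶_)
open import Data.Bool using (true; false; if_then_else_)
open import Data.Integer as ℤ using (ℤ; -[1+_]; ∣_∣; _⊖_)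
open import Data.Integer using () renaming (_+_ to infixl 6 _+ᶻ_)
import Data.Integer.Properties as ℤ
open import Data.List using ([]; _∷_; foldr; applyUpTo)
open import Data.List.Properties using (map-upTo)
open import Data.Maybe using (just; nothing)
open import Data.Nat as ℕ using (zero; suc; _∸_; _/_; _<_; _≤ᵇ_; z≤n; s≤s; parity)
open import Data.Nat.Divisibility as ℕ using (∣m∣n⇒∣m+n; ∣-refl; _∣0)
open import Data.Nat.DivMod using (m≡m%n+[m/n]*n; m*n/n≡m; m%n<n; %-distribˡ-*; [m+kn]%n≡m%n)
open import Data.Nat.Primality using (euclidsLemma; prime⇒nonZero)
import Data.Nat.Properties as ℕ
open import Data.Nat.Tactic.RingSolver using () renaming (solve to solveℕ; solve-∀ to solveℕ-∀)
-- The library gives both operations on Parity the same precedence.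
open import Data.Parity.Base using (Parity; 0ℙ; 1ℙ)
  renaming (_+_ to infixl 6 _+ₚ_; _*_ to infixl 7 _*ₚ_)
import Data.Parity.Properties as ℙ
open import Data.Product using (_,_; ∃-syntax)
open import Data.Sum using (inj₁; inj₂; [_,_]′)
open import Function using (_∘_; id)
open import Level using (0ℓ)
open import Relation.Binary.Definitions using (WeaklyDecidable)
open import Relation.Binary.PropositionalEquality
  using (_≢_; refl; sym; trans; cong; cong₂; subst; module ≡-Reasoning)
import Relation.Binary.Reasoning.Setoid as SetoidReasoning
open import Relation.Nullary using (yes; no; contradiction; ofʸ; ofⁿ)
open import Relation.Nullary.Decidable using (from-yes; _→-dec_)

-- Formal power series over the field of two elements

-- Two tools carry the proof: truncation modulo q^n, under which an equation with a factor q in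
-- front of the unknown can be solved degree by degree, and the rule that f² has the coefficient
-- f(n) at 2n and 0 at odd places. For the first reason both of Shanks' arguments appear in their
-- finite form. The dissection that the overview only names: divide f³ = f₃ + q f₉³ by f₃⁹. The
-- exponents 1 modulo 3 form q f₉³ / f₃⁹, which becomes f₃³ / f⁹ once q³ is replaced by q. Dividing
-- f³ f₃³ = f¹² + q f₃¹² by f¹² turns this into 1 + q K⁴ with K = f₃³ / f³, and dividing the same
-- relation by f⁶ gives K = f⁶ + q (f₃⁶ / f³)². So the coefficient at 1 + 4m is that of K at m, and
-- for m = 2r it is that of f³ at r.

PS : Set
PS = ℕ → Parity

infix 4 _≈_ _≈[_]_
infixl 6 _⊕_
infixl 7 _⊛_

-- A record rather than a bare function type, so that `f` and `g` can be inferred from the type of a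
-- proof.
record _≈_ (f g : PS) : Set where
  constructor pointwise
  field at : ∀ n → f n ≡ g n
open _≈_

record _≈[_]_ (f : PS) (n : ℕ) (g : PS) : Set where
  constructor below
  field atBelow : ∀ i → i < n → f i ≡ g i
open _≈[_]_

tail : PS → PS
tail f n = f (suc n)

shift : PS → PS
shift f zero    = 0ℙ
shift f (suc n) = f n

const : Parity → PS
const c zero    = c
const c (suc n) = 0ℙ

𝟘 𝟙 q : PS
𝟘 _ = 0ℙ
𝟙 = const 1ℙ
q = shift 𝟙

_⊕_ : PS → PS → PS
(f ⊕ g) n = f n +ₚ g n

-- The Cauchy product as the recursion f g = f(0) g + q (tail f) g, which avoids finite sums.
_⊛_ : PS → PS → PS
(f ⊛ g) zero    = f 0 *ₚ g 0
(f ⊛ g) (suc n) = f 0 *ₚ g (suc n) +ₚ (tail f ⊛ g) n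

⊛-cong-≤ : ∀ {f f′ g g′} n → (∀ i → i ≤ n → f i ≡ f′ i) → (∀ i → i ≤ n → g i ≡ g′ i) →
           (f ⊛ g) n ≡ (f′ ⊛ g′) n
⊛-cong-≤ zero    p r = cong₂ _*ₚ_ (p 0 z≤n) (r 0 z≤n)
⊛-cong-≤ (suc n) p r = cong₂ _+ₚ_
  (cong₂ _*ₚ_ (p 0 z≤n) (r (suc n) ℕ.≤-refl))
  (⊛-cong-≤ n (λ i i≤n → p (suc i) (s≤s i≤n)) (λ i i≤n → r i (ℕ.m≤n⇒m≤1+n i≤n)))

-- The mirror image of the defining recursion, peeling the right factor; commutativity follows by
-- playing one against the other.
⊛-suc : ∀ f g n → (f ⊛ g) (suc n) ≡ (f ⊛ tail g) n +ₚ f (suc n) *ₚ g 0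
⊛-suc f g zero    = refl
⊛-suc f g (suc n) = trans
  (cong (f 0 *ₚ g (2 + n) +ₚ_) (⊛-suc (tail f) g n))
  (sym (ℙ.+-assoc (f 0 *ₚ g (2 + n)) _ _))

⊛-comm-at : ∀ f g n → (f ⊛ g) n ≡ (g ⊛ f) n
⊛-comm-at f g zero    = ℙ.*-comm (f 0) (g 0)
⊛-comm-at f g (suc n) = begin
  f 0 *ₚ g (suc n) +ₚ (tail f ⊛ g) n ≡⟨ ℙ.+-comm (f 0 *ₚ g (suc n)) _ ⟩
  (tail f ⊛ g) n +ₚ f 0 *ₚ g (suc n) ≡⟨ cong₂ _+ₚ_ (⊛-comm-at (tail f) g n) (ℙ.*-comm (f 0) _) ⟩
  (g ⊛ tail f) n +ₚ g (suc n) *ₚ f 0 ≡⟨ ⊛-suc g f n ⟨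
  (g ⊛ f) (suc n)                      ∎
  where open ≡-Reasoning

⊛-distribʳ-at : ∀ h f g n → ((f ⊕ g) ⊛ h) n ≡ (f ⊛ h) n +ₚ (g ⊛ h) n
⊛-distribʳ-at h f g zero    = ℙ.*-distribʳ-+ (h 0) (f 0) (g 0)
⊛-distribʳ-at h f g (suc n) = trans
  (cong₂ _+ₚ_ (ℙ.*-distribʳ-+ (h (suc n)) (f 0) (g 0)) (⊛-distribʳ-at h (tail f) (tail g) n))
  (medial (f 0 *ₚ h (suc n)) _ _ _)
  where open CommutativeSemigroupProperties ℙ.+-commutativeSemigroup renaming (interchange to medial)

⊛-zeroˡ-at : ∀ g n → (𝟘 ⊛ g) n ≡ 0ℙ
⊛-zeroˡ-at g zero    = refl
⊛-zeroˡ-at g (suc n) = ⊛-zeroˡ-at g n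

⊛-scale-at : ∀ c f g n → ((λ i → c *ₚ f i) ⊛ g) n ≡ c *ₚ (f ⊛ g) n
⊛-scale-at 0ℙ f g n = ⊛-zeroˡ-at g n
⊛-scale-at 1ℙ f g n = refl

⊛-assoc-at : ∀ f g h n → ((f ⊛ g) ⊛ h) n ≡ (f ⊛ (g ⊛ h)) n
⊛-assoc-at f g h zero    = ℙ.*-assoc (f 0) (g 0) (h 0)
⊛-assoc-at f g h (suc n) = begin
  f 0 *ₚ g 0 *ₚ h (suc n) +ₚ (tail (f ⊛ g) ⊛ h) n
    -- `tail (f ⊛ g)` unfolds to a sum, f(0) times `tail g` plus `tail f ⊛ g`.
    ≡⟨ cong₂ _+ₚ_ (ℙ.*-assoc (f 0) (g 0) _) (⊛-distribʳ-at h (λ i → f 0 *ₚ tail g i) (tail f ⊛ g) n) ⟩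
  x +ₚ (((λ i → f 0 *ₚ tail g i) ⊛ h) n +ₚ ((tail f ⊛ g) ⊛ h) n)
    ≡⟨ cong (x +ₚ_) (cong₂ _+ₚ_ (⊛-scale-at (f 0) (tail g) h n) (⊛-assoc-at (tail f) g h n)) ⟩
  x +ₚ (f 0 *ₚ (tail g ⊛ h) n +ₚ (tail f ⊛ (g ⊛ h)) n)
    ≡⟨ ℙ.+-assoc x _ _ ⟨
  x +ₚ f 0 *ₚ (tail g ⊛ h) n +ₚ (tail f ⊛ (g ⊛ h)) n
    ≡⟨ cong (_+ₚ (tail f ⊛ (g ⊛ h)) n) (ℙ.*-distribˡ-+ (f 0) (g 0 *ₚ h (suc n)) _) ⟨
  f 0 *ₚ (g ⊛ h) (suc n) +ₚ (tail f ⊛ (g ⊛ h)) n ∎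
  where
  open ≡-Reasoning
  x = f 0 *ₚ (g 0 *ₚ h (suc n))

⊛-identityˡ-at : ∀ f n → (𝟙 ⊛ f) n ≡ f n
⊛-identityˡ-at f zero    = refl
⊛-identityˡ-at f (suc n) = trans (cong (f (suc n) +ₚ_) (⊛-zeroˡ-at f n)) (ℙ.+-identityʳ _)

PS-commutativeRing : CommutativeRing 0ℓ 0ℓ
PS-commutativeRing = record
  { Carrier = PS ; _≈_ = _≈_ ; _+_ = _⊕_ ; _*_ = _⊛_ ; -_ = id ; 0# = 𝟘 ; 1# = 𝟙
  ; isCommutativeRing = record
    { isRing = record
      { +-isAbelianGroup = record
        { isGroup = record
          { isMonoid = record
            { isSemigroup = record
              { isMagma = record
                { isEquivalence = record
                  { refl  = pointwise λ _ → refl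
                  ; sym   = λ p → pointwise λ n → sym (at p n)
                  ; trans = λ p r → pointwise λ n → trans (at p n) (at r n)
                  }
                ; ∙-cong = λ p r → pointwise λ n → cong₂ _+ₚ_ (at p n) (at r n)
                }
              ; assoc = λ f g h → pointwise λ n → ℙ.+-assoc (f n) (g n) (h n)
              }
            ; identity = (λ f → pointwise λ n → refl) , λ f → pointwise λ n → ℙ.+-identityʳ (f n)
            }
          ; inverse = (λ f → pointwise λ n → ℙ.p+p≡0ℙ (f n)) , λ f → pointwise λ n → ℙ.p+p≡0ℙ (f n)
          ; ⁻¹-cong = id
          }
        ; comm = λ f g → pointwise λ n → ℙ.+-comm (f n) (g n)
        }
      ; *-cong = λ p r → pointwise λ n → ⊛-cong-≤ n (λ i _ → at p i) (λ i _ → at r i)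
      ; *-assoc = λ f g h → pointwise (⊛-assoc-at f g h)
      ; *-identity = (λ f → pointwise (⊛-identityˡ-at f))
                   , (λ f → pointwise λ n → trans (⊛-comm-at f 𝟙 n) (⊛-identityˡ-at f n))
      ; distrib = (λ f g h → pointwise λ n → trans (⊛-comm-at f (g ⊕ h) n)
                     (trans (⊛-distribʳ-at f g h n) (cong₂ _+ₚ_ (⊛-comm-at g f n) (⊛-comm-at h f n))))
                , (λ f g h → pointwise (⊛-distribʳ-at f g h))
      }
    ; *-comm = λ f g → pointwise (⊛-comm-at f g)
    }
  }

open CommutativeRing PS-commutativeRing
  using (semiring; setoid; *-assoc; *-comm; *-identityˡ; *-identityʳ; zeroˡ; zeroʳ;
         +-identityˡ; +-identityʳ; +-cong; +-congˡ; +-congʳ; *-cong; *-congˡ; *-congʳ)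
  renaming (refl to ≈-refl; sym to ≈-sym; trans to ≈-trans)
open Exp semiring using (^-congˡ; ^-congʳ; ^-homo-*; ^-assocʳ) renaming (_^_ to _↑_)
open CommutativeExp (CommutativeRing.commutativeSemiring PS-commutativeRing) using (^-distrib-*)
module ≈-Reasoning = SetoidReasoning setoid

⊕-congˡ : ∀ f {g h} → g ≈ h → f ⊕ g ≈ f ⊕ h
⊕-congˡ f = +-congˡ {f}

const-* : ∀ a b → const (a *ₚ b) ≈ const a ⊛ const b
const-* a b = pointwise λ
  { zero → refl ; (suc n) → sym (cong₂ _+ₚ_ (ℙ.*-zeroʳ a) (⊛-zeroˡ-at (const b) n)) }

-- Unlike `const 0ℙ`, the value at `0ℙ` is `𝟘` itself, so that solver constants agree with the terms
-- by computation.
embed : Parity → PS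
embed 0ℙ = 𝟘
embed 1ℙ = 𝟙

constants : CommutativeRing.rawRing ℙ.+-*-commutativeRing
            -Raw-AlmostCommutative⟶ fromCommutativeRing PS-commutativeRing
constants = record
  { ⟦_⟧    = embed
  ; +-homo = λ { 0ℙ b → ≈-refl ; 1ℙ 0ℙ → ≈-sym (+-identityʳ 𝟙) ; 1ℙ 1ℙ → pointwise λ n → sym (ℙ.p+p≡0ℙ (𝟙 n)) }
  ; *-homo = λ { 0ℙ b → ≈-sym (zeroˡ (embed b)) ; 1ℙ b → ≈-sym (*-identityˡ (embed b)) }
  ; -‿homo = λ _ → ≈-refl
  ; 0-homo = ≈-refl
  ; 1-homo = ≈-refl
  }

embed-≟ : WeaklyDecidable {A = Parity} (λ a b → embed a ≈ embed b)
embed-≟ 0ℙ 0ℙ = just ≈-refl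
embed-≟ 1ℙ 1ℙ = just ≈-refl
embed-≟ _  _  = nothing

-- The coefficients of the solver are parities, so that it knows f ⊕ f ≈ 𝟘.
open RingSolver (CommutativeRing.rawRing ℙ.+-*-commutativeRing)
  (fromCommutativeRing PS-commutativeRing) constants embed-≟
  using (solve; _:=_; con; _:+_; _:*_; _:^_)

-- Congruence modulo a power of q

≈⇒≈[] : ∀ {f g n} → f ≈ g → f ≈[ n ] g
≈⇒≈[] p = below λ i _ → at p i

≈[]⇒≈ : ∀ {f g} → (∀ n → f ≈[ n ] g) → f ≈ g
≈[]⇒≈ p = pointwise λ n → atBelow (p (suc n)) n ℕ.≤-refl

≈[]-refl : ∀ {f n} → f ≈[ n ] f
≈[]-refl = below λ _ _ → refl

≈[]-sym : ∀ {f g n} → f ≈[ n ] g → g ≈[ n ] f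
≈[]-sym p = below λ i i<n → sym (atBelow p i i<n)

≈[]-trans : ∀ {f g h n} → f ≈[ n ] g → g ≈[ n ] h → f ≈[ n ] h
≈[]-trans p r = below λ i i<n → trans (atBelow p i i<n) (atBelow r i i<n)

≈[]-weaken : ∀ {f g m n} → m ≤ n → f ≈[ n ] g → f ≈[ m ] g
≈[]-weaken m≤n p = below λ i i<m → atBelow p i (ℕ.<-≤-trans i<m m≤n)

⊕-cong[] : ∀ {f f′ g g′ n} → f ≈[ n ] f′ → g ≈[ n ] g′ → f ⊕ g ≈[ n ] f′ ⊕ g′
⊕-cong[] p r = below λ i i<n → cong₂ _+ₚ_ (atBelow p i i<n) (atBelow r i i<n)

⊛-cong[] : ∀ {f f′ g g′ n} → f ≈[ n ] f′ → g ≈[ n ] g′ → f ⊛ g ≈[ n ] f′ ⊛ g′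
⊛-cong[] p r = below λ i i<n → ⊛-cong-≤ i
  (λ j j≤i → atBelow p j (ℕ.≤-<-trans j≤i i<n)) (λ j j≤i → atBelow r j (ℕ.≤-<-trans j≤i i<n))

⊕-congˡ[] : ∀ f {g g′ n} → g ≈[ n ] g′ → f ⊕ g ≈[ n ] f ⊕ g′
⊕-congˡ[] f = ⊕-cong[] (≈[]-refl {f})

⊛-congˡ[] : ∀ f {g g′ n} → g ≈[ n ] g′ → f ⊛ g ≈[ n ] f ⊛ g′
⊛-congˡ[] f = ⊛-cong[] (≈[]-refl {f})

↑-cong[] : ∀ {f g n} k → f ≈[ n ] g → f ↑ k ≈[ n ] g ↑ k
↑-cong[] zero    p = ≈[]-refl
↑-cong[] (suc k) p = ⊛-cong[] p (↑-cong[] k p)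

q⊛≈shift : ∀ f → q ⊛ f ≈ shift f
q⊛≈shift f = pointwise λ { zero → refl ; (suc n) → ⊛-identityˡ-at f n }

-- The factor q gains one coefficient of precision; this drives every induction on the precision
-- below.
q⊛-cong[] : ∀ {f g n} → f ≈[ n ] g → q ⊛ f ≈[ suc n ] q ⊛ g
q⊛-cong[] {f} {g} p = ≈[]-trans (≈⇒≈[] (q⊛≈shift f)) (≈[]-trans shifted (≈⇒≈[] (≈-sym (q⊛≈shift g))))
  where shifted = below λ { zero _ → refl ; (suc i) (s≤s i<n) → atBelow p i i<n }

q↑⊛-at : ∀ m g k → (q ↑ m ⊛ g) (m + k) ≡ g k
q↑⊛-at zero    g k = ⊛-identityˡ-at g k
q↑⊛-at (suc m) g k = trans (at (≈-trans (*-assoc q (q ↑ m) g) (q⊛≈shift (q ↑ m ⊛ g))) (suc m + k))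
  (q↑⊛-at m g k)

q↑⊛≈[]𝟘 : ∀ n f → q ↑ n ⊛ f ≈[ n ] 𝟘
q↑⊛≈[]𝟘 zero    f = below λ _ ()
q↑⊛≈[]𝟘 (suc n) f = ≈[]-trans (≈⇒≈[] (*-assoc q (q ↑ n) f))
  (≈[]-trans (q⊛-cong[] (q↑⊛≈[]𝟘 n f)) (≈⇒≈[] (zeroʳ q)))

q↑≈[]𝟘 : ∀ n → q ↑ n ≈[ n ] 𝟘
q↑≈[]𝟘 n = ≈[]-trans (≈⇒≈[] (≈-sym (*-identityʳ (q ↑ n)))) (q↑⊛≈[]𝟘 n 𝟙)

⊕≈[] : ∀ {m n} f → m ≤ n → f ⊕ q ↑ n ≈[ m ] f
⊕≈[] {n = n} f m≤n = ≈[]-trans (⊕-congˡ[] f (≈[]-weaken m≤n (q↑≈[]𝟘 n)))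
  (≈⇒≈[] (pointwise λ k → ℙ.+-identityʳ (f k)))

head-tail : ∀ f → f ≈ const (f 0) ⊕ q ⊛ tail f
head-tail f = pointwise λ
  { zero → sym (ℙ.+-identityʳ (f 0)) ; (suc n) → sym (at (q⊛≈shift (tail f)) (suc n)) }

-- Limits and inverses

-- If `X (suc n) ≈[ n ] X n` for all n, the coefficient at n is final from index n + 1 on.
lim : (ℕ → PS) → PS
lim X n = X (suc n) n

module _ (X : ℕ → PS) (cauchy : ∀ n → X (suc n) ≈[ n ] X n) where

  ≈[]-later : ∀ m d → X (d + m) ≈[ m ] X m
  ≈[]-later m zero    = ≈[]-refl
  ≈[]-later m (suc d) = ≈[]-trans (≈[]-weaken (ℕ.m≤n+m m d) (cauchy (d + m))) (≈[]-later m d)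

  lim≈[] : ∀ n → lim X ≈[ n ] X n
  lim≈[] n = below λ i i<n → sym (subst (λ k → X k i ≡ X (suc i) i) (ℕ.m∸n+n≡m i<n)
    (atBelow (≈[]-later (suc i) (n ℕ.∸ suc i)) i ℕ.≤-refl))

-- For f = 1 + q t the inverse is the fixed point of x ↦ 1 + q t x modulo 2; each iteration settles
-- one more coefficient.
inverseApprox : PS → ℕ → PS
inverseApprox f zero    = 𝟙
inverseApprox f (suc k) = 𝟙 ⊕ q ⊛ (tail f ⊛ inverseApprox f k)

inverseApprox-cauchy : ∀ f k → inverseApprox f (suc k) ≈[ k ] inverseApprox f k
inverseApprox-cauchy f zero    = below λ _ ()
inverseApprox-cauchy f (suc k) =
  ⊕-congˡ[] 𝟙 (q⊛-cong[] (⊛-congˡ[] (tail f) (inverseApprox-cauchy f k)))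

inverse : PS → PS
inverse f = lim (inverseApprox f)

inverse-fix : ∀ f → inverse f ≈ 𝟙 ⊕ q ⊛ (tail f ⊛ inverse f)
inverse-fix f = ≈[]⇒≈ λ n → ≈[]-trans
  (≈[]-weaken (ℕ.n≤1+n n) (lim≈[] _ (inverseApprox-cauchy f) (suc n)))
  (⊕-congˡ[] 𝟙 (≈[]-weaken (ℕ.n≤1+n n)
    (q⊛-cong[] (⊛-congˡ[] (tail f) (≈[]-sym (lim≈[] _ (inverseApprox-cauchy f) n))))))

⊛-inverseʳ : ∀ f → f 0 ≡ 1ℙ → f ⊛ inverse f ≈ 𝟙
⊛-inverseʳ f f0≡1 = begin
  f ⊛ i                    ≈⟨ *-congʳ (head-tail f) ⟩
  (const (f 0) ⊕ q ⊛ t) ⊛ i ≡⟨ cong (λ c → (const c ⊕ q ⊛ t) ⊛ i) f0≡1 ⟩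
  (𝟙 ⊕ q ⊛ t) ⊛ i          ≈⟨ solve 3 (λ q t i → (con 1ℙ :+ q :* t) :* i := i :+ q :* (t :* i)) ≈-refl q t i ⟩
  i ⊕ q ⊛ (t ⊛ i)          ≈⟨ +-congʳ (inverse-fix f) ⟩
  𝟙 ⊕ q ⊛ (t ⊛ i) ⊕ q ⊛ (t ⊛ i) ≈⟨ solve 1 (λ x → con 1ℙ :+ x :+ x := con 1ℙ) ≈-refl (q ⊛ (t ⊛ i)) ⟩
  𝟙                        ∎
  where
  open ≈-Reasoning
  i = inverse f
  t = tail f

⊛-cancelˡ : ∀ u {f g} → u 0 ≡ 1ℙ → u ⊛ f ≈ u ⊛ g → f ≈ g
⊛-cancelˡ u {f} {g} u0≡1 uf≈ug = begin
  f                   ≈⟨ *-identityˡ f ⟨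
  𝟙 ⊛ f               ≈⟨ *-congʳ iu≈𝟙 ⟨
  inverse u ⊛ u ⊛ f   ≈⟨ *-assoc (inverse u) u f ⟩
  inverse u ⊛ (u ⊛ f) ≈⟨ *-congˡ uf≈ug ⟩
  inverse u ⊛ (u ⊛ g) ≈⟨ *-assoc (inverse u) u g ⟨
  inverse u ⊛ u ⊛ g   ≈⟨ *-congʳ iu≈𝟙 ⟩
  𝟙 ⊛ g               ≈⟨ *-identityˡ g ⟩
  g                   ∎
  where
  open ≈-Reasoning
  iu≈𝟙 = ≈-trans (*-comm (inverse u) u) (⊛-inverseʳ u u0≡1)

-- The substitution q ↦ q³

triple : PS → PS
triple f 0 = f 0
triple f 1 = 0ℙ
triple f 2 = 0ℙ
triple f (suc (suc (suc n))) = triple (tail f) n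

triple-cong-≤ : ∀ {f g} n → (∀ i → i ≤ n → f i ≡ g i) → triple f n ≡ triple g n
triple-cong-≤ 0 p = p 0 z≤n
triple-cong-≤ 1 p = refl
triple-cong-≤ 2 p = refl
triple-cong-≤ (suc (suc (suc n))) p =
  triple-cong-≤ n λ i i≤n → p (suc i) (s≤s (ℕ.≤-trans i≤n (ℕ.m≤n+m n 2)))

triple-cong[] : ∀ {f g n} → f ≈[ n ] g → triple f ≈[ n ] triple g
triple-cong[] p = below λ i i<n → triple-cong-≤ i λ j j≤i → atBelow p j (ℕ.≤-<-trans j≤i i<n)

triple-cong : ∀ {f g} → f ≈ g → triple f ≈ triple g
triple-cong p = ≈[]⇒≈ λ n → triple-cong[] (≈⇒≈[] p)

triple-⊕-at : ∀ f g n → triple (f ⊕ g) n ≡ triple f n +ₚ triple g n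
triple-⊕-at f g 0 = refl
triple-⊕-at f g 1 = refl
triple-⊕-at f g 2 = refl
triple-⊕-at f g (suc (suc (suc n))) = triple-⊕-at (tail f) (tail g) n

triple-⊕ : ∀ f g → triple (f ⊕ g) ≈ triple f ⊕ triple g
triple-⊕ f g = pointwise (triple-⊕-at f g)

triple-head-tail : ∀ f → triple f ≈ const (f 0) ⊕ q ↑ 3 ⊛ triple (tail f)
triple-head-tail f = pointwise λ
  { 0 → sym (ℙ.+-identityʳ (f 0)) ; 1 → refl ; 2 → refl
  ; (suc (suc (suc n))) → sym (q↑⊛-at 3 (triple (tail f)) n) }

triple-𝟘-at : ∀ n → triple 𝟘 n ≡ 0ℙ
triple-𝟘-at 0 = refl
triple-𝟘-at 1 = refl
triple-𝟘-at 2 = refl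
triple-𝟘-at (suc (suc (suc n))) = triple-𝟘-at n

triple-const : ∀ c → triple (const c) ≈ const c
triple-const c = pointwise λ
  { 0 → refl ; 1 → refl ; 2 → refl ; (suc (suc (suc n))) → triple-𝟘-at n }

triple-q : triple q ≈ q ↑ 3
triple-q = begin
  triple q                     ≈⟨ triple-head-tail q ⟩
  const 0ℙ ⊕ q ↑ 3 ⊛ triple 𝟙  ≈⟨ +-cong const-0 (*-congˡ (triple-const 1ℙ)) ⟩
  𝟘 ⊕ q ↑ 3 ⊛ 𝟙                ≈⟨ solve 1 (λ x → con 0ℙ :+ x :* con 1ℙ := x) ≈-refl (q ↑ 3) ⟩
  q ↑ 3                        ∎
  where
  open ≈-Reasoning
  const-0 : const 0ℙ ≈ 𝟘
  const-0 = pointwise λ { zero → refl ; (suc _) → refl }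

-- Both sides have the form constant plus q³ times products of the same kind with a tail in them, so
-- induction on the precision, for all f and g at once, closes the recursion.
triple-⊛[] : ∀ n f g → triple (f ⊛ g) ≈[ n ] triple f ⊛ triple g
triple-⊛[] zero    f g = below λ _ ()
triple-⊛[] (suc n) f g = ≈[]-trans (≈⇒≈[] (triple-head-tail (f ⊛ g)))
  (≈[]-trans (⊕-congˡ[] (const (f 0 *ₚ g 0)) q³-step) (≈⇒≈[] (≈-sym rhs)))
  where
  cf = const (f 0)
  cg = const (g 0)
  Y = cf ⊛ triple (tail g) ⊕ triple (tail f) ⊛ triple g

  tail-⊛ : tail (f ⊛ g) ≈ cf ⊛ tail g ⊕ tail f ⊛ g
  tail-⊛ = pointwise λ k → cong (_+ₚ (tail f ⊛ g) k) (sym (const-⊛ k))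
    where
    const-⊛ : ∀ k → (cf ⊛ tail g) k ≡ f 0 *ₚ tail g k
    const-⊛ zero = refl
    const-⊛ (suc k) = trans (cong (f 0 *ₚ g (2 + k) +ₚ_) (⊛-zeroˡ-at (tail g) k)) (ℙ.+-identityʳ _)

  step : triple (tail (f ⊛ g)) ≈[ n ] Y
  step = ≈[]-trans (≈⇒≈[] (≈-trans (triple-cong tail-⊛) (triple-⊕ (cf ⊛ tail g) (tail f ⊛ g))))
    (⊕-cong[] (≈[]-trans (triple-⊛[] n cf (tail g)) (⊛-cong[] (≈⇒≈[] (triple-const (f 0))) ≈[]-refl))
              (triple-⊛[] n (tail f) g))

  -- One of the three factors q already supplies the missing coefficient.
  q³-step : q ↑ 3 ⊛ triple (tail (f ⊛ g)) ≈[ suc n ] q ↑ 3 ⊛ Y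
  q³-step = ≈[]-trans (≈⇒≈[] (*-assoc q (q ↑ 2) _)) (≈[]-trans (q⊛-cong[] (⊛-congˡ[] (q ↑ 2) step))
    (≈⇒≈[] (≈-sym (*-assoc q (q ↑ 2) _))))

  rhs : triple f ⊛ triple g ≈ const (f 0 *ₚ g 0) ⊕ q ↑ 3 ⊛ Y
  rhs = begin
    triple f ⊛ triple g
      ≈⟨ *-congʳ (triple-head-tail f) ⟩
    (cf ⊕ q ↑ 3 ⊛ triple (tail f)) ⊛ triple g
      ≈⟨ solve 4 (λ x y z w → (x :+ y :* z) :* w := x :* w :+ y :* (z :* w)) ≈-refl
           cf (q ↑ 3) (triple (tail f)) (triple g) ⟩
    cf ⊛ triple g ⊕ q ↑ 3 ⊛ (triple (tail f) ⊛ triple g)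
      ≈⟨ +-congʳ (*-congˡ (triple-head-tail g)) ⟩
    cf ⊛ (cg ⊕ q ↑ 3 ⊛ triple (tail g)) ⊕ q ↑ 3 ⊛ (triple (tail f) ⊛ triple g)
      ≈⟨ solve 5 (λ x y z t w → x :* (y :+ z :* t) :+ z :* w := x :* y :+ z :* (x :* t :+ w)) ≈-refl
           cf cg (q ↑ 3) (triple (tail g)) (triple (tail f) ⊛ triple g) ⟩
    cf ⊛ cg ⊕ q ↑ 3 ⊛ Y
      ≈⟨ +-congʳ (≈-sym (const-* (f 0) (g 0))) ⟩
    const (f 0 *ₚ g 0) ⊕ q ↑ 3 ⊛ Y ∎
    where open ≈-Reasoning

triple-⊛ : ∀ f g → triple (f ⊛ g) ≈ triple f ⊛ triple g
triple-⊛ f g = ≈[]⇒≈ λ n → triple-⊛[] n f g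

triple-↑ : ∀ f n → triple (f ↑ n) ≈ triple f ↑ n
triple-↑ f zero    = triple-const 1ℙ
triple-↑ f (suc n) = ≈-trans (triple-⊛ f (f ↑ n)) (*-congˡ (triple-↑ f n))

triple-3n : ∀ f n → triple f (n * 3) ≡ f n
triple-3n f zero    = refl
triple-3n f (suc n) = triple-3n (tail f) n

triple-1+3n : ∀ f n → triple f (1 + n * 3) ≡ 0ℙ
triple-1+3n f zero    = refl
triple-1+3n f (suc n) = triple-1+3n (tail f) n

-- Squares modulo 2

square-head-tail : ∀ f → f ↑ 2 ≈ const (f 0) ⊕ q ⊛ (q ⊛ tail f ↑ 2)
square-head-tail f = begin
  f ↑ 2                           ≈⟨ ^-congˡ 2 (head-tail f) ⟩
  (const (f 0) ⊕ q ⊛ t) ↑ 2       ≈⟨ solve 3 (λ c q t → (c :+ q :* t) :^ 2 := c :* c :+ q :* (q :* t :^ 2)) ≈-refl (const (f 0)) q t ⟩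
  const (f 0) ⊛ const (f 0) ⊕ q ⊛ (q ⊛ t ↑ 2) ≈⟨ +-congʳ (const-idem (f 0)) ⟩
  const (f 0) ⊕ q ⊛ (q ⊛ t ↑ 2)   ∎
  where
  open ≈-Reasoning
  t = tail f
  const-idem : ∀ c → const c ⊛ const c ≈ const c
  const-idem c = ≈-trans (≈-sym (const-* c c)) (pointwise λ n → cong (λ d → const d n) (ℙ.*-idem c))

square-at-2+ : ∀ f n → (f ↑ 2) (2 + n) ≡ (tail f ↑ 2) n
square-at-2+ f n = trans (at (square-head-tail f) (2 + n))
  (trans (at (q⊛≈shift (q ⊛ tail f ↑ 2)) (2 + n)) (at (q⊛≈shift (tail f ↑ 2)) (1 + n)))

square-even : ∀ f n → (f ↑ 2) (n * 2) ≡ f n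
square-even f zero    = trans (cong (f 0 *ₚ_) (ℙ.*-identityʳ (f 0))) (ℙ.*-idem (f 0))
square-even f (suc n) = trans (square-at-2+ f (n * 2)) (square-even (tail f) n)

square-odd : ∀ f n → (f ↑ 2) (1 + n * 2) ≡ 0ℙ
square-odd f zero    = trans (at (square-head-tail f) 1) (at (q⊛≈shift (q ⊛ tail f ↑ 2)) 1)
square-odd f (suc n) = trans (square-at-2+ f (1 + n * 2)) (square-odd (tail f) n)

-- The dissections

module Dissection (a : PS) (a0≡1 : a 0 ≡ 1ℙ)
  (a³≈ : a ↑ 3 ≈ triple a ⊕ q ⊛ triple (triple a) ↑ 3) where

  -- In the notation of the overview a = f, b = f₃, c = f₉ and i = 1/f.
  b c i D : PS
  b = triple a
  c = triple b
  i = inverse a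
  D = a ↑ 3 ⊛ b ↑ 3 ⊕ a ↑ 12 ⊕ q ⊛ b ↑ 12

  triple-D : triple D ≈ b ↑ 3 ⊛ c ↑ 3 ⊕ b ↑ 12 ⊕ q ↑ 3 ⊛ c ↑ 12
  triple-D = ≈-trans (triple-⊕ (a ↑ 3 ⊛ b ↑ 3 ⊕ a ↑ 12) (q ⊛ b ↑ 12)) (+-cong
    (≈-trans (triple-⊕ (a ↑ 3 ⊛ b ↑ 3) (a ↑ 12)) (+-cong
      (≈-trans (triple-⊛ (a ↑ 3) (b ↑ 3)) (*-cong (triple-↑ a 3) (triple-↑ b 3)))
      (triple-↑ a 12)))
    (≈-trans (triple-⊛ q (b ↑ 12)) (*-cong triple-q (triple-↑ b 12))))

  D≈q⊛triple-D : D ≈ q ⊛ triple D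
  D≈q⊛triple-D = begin
    D ≈⟨ solve 3 (λ q a b → a :^ 3 :* b :^ 3 :+ a :^ 12 :+ q :* b :^ 12 :=
                            a :^ 3 :* b :^ 3 :+ (a :^ 3) :^ 4 :+ q :* b :^ 12) ≈-refl q a b ⟩
    a ↑ 3 ⊛ b ↑ 3 ⊕ (a ↑ 3) ↑ 4 ⊕ q ⊛ b ↑ 12
      ≈⟨ +-congʳ (+-cong (*-congʳ a³≈) (^-congˡ 4 a³≈)) ⟩
    (b ⊕ q ⊛ c ↑ 3) ⊛ b ↑ 3 ⊕ (b ⊕ q ⊛ c ↑ 3) ↑ 4 ⊕ q ⊛ b ↑ 12
      -- The fourth power is b⁴ + q⁴ c¹²; its b⁴ cancels the one from the first product, and q
      -- divides all that is left.
      ≈⟨ solve 3 (λ q b c →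
           (b :+ q :* c :^ 3) :* b :^ 3 :+ (b :+ q :* c :^ 3) :^ 4 :+ q :* b :^ 12 :=
           q :* (b :^ 3 :* c :^ 3 :+ b :^ 12 :+ q :^ 3 :* c :^ 12)) ≈-refl q b c ⟩
    q ⊛ (b ↑ 3 ⊛ c ↑ 3 ⊕ b ↑ 12 ⊕ q ↑ 3 ⊛ c ↑ 12)
      ≈⟨ *-congˡ triple-D ⟨
    q ⊛ triple D ∎
    where open ≈-Reasoning

  -- If D vanishes modulo q^n, so does D(q³), and then D = q D(q³) vanishes modulo q^(n+1).
  D≈[]𝟘 : ∀ n → D ≈[ n ] 𝟘
  D≈[]𝟘 zero    = below λ _ ()
  D≈[]𝟘 (suc n) = ≈[]-trans (≈⇒≈[] D≈q⊛triple-D) (≈[]-trans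
    (q⊛-cong[] (≈[]-trans (triple-cong[] (D≈[]𝟘 n)) (≈⇒≈[] (pointwise triple-𝟘-at))))
    (≈⇒≈[] (zeroʳ q)))

  a³b³≈ : a ↑ 3 ⊛ b ↑ 3 ≈ a ↑ 12 ⊕ q ⊛ b ↑ 12
  a³b³≈ = begin
    a ↑ 3 ⊛ b ↑ 3 ≈⟨ solve 3 (λ x y z → x := x :+ y :+ z :+ (y :+ z)) ≈-refl (a ↑ 3 ⊛ b ↑ 3) (a ↑ 12) (q ⊛ b ↑ 12) ⟩
    D ⊕ (a ↑ 12 ⊕ q ⊛ b ↑ 12) ≈⟨ +-congʳ (≈[]⇒≈ D≈[]𝟘) ⟩
    𝟘 ⊕ (a ↑ 12 ⊕ q ⊛ b ↑ 12) ≈⟨ +-identityˡ _ ⟩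
    a ↑ 12 ⊕ q ⊛ b ↑ 12 ∎
    where open ≈-Reasoning

  ai≈𝟙 : a ⊛ i ≈ 𝟙
  ai≈𝟙 = ⊛-inverseʳ a a0≡1

  -- The ring solver does not know a ⊛ i ≈ 𝟙, so that the factors to be cancelled are
  -- inserted by hand.
  pad : ∀ n f → f ≈ f ⊛ (a ⊛ i) ↑ n
  pad n f = ≈-sym (≈-trans (*-congˡ (≈-trans (^-congˡ n ai≈𝟙) (𝟙↑ n))) (*-identityʳ f))
    where
    𝟙↑ : ∀ n → 𝟙 ↑ n ≈ 𝟙
    𝟙↑ zero    = ≈-refl
    𝟙↑ (suc n) = ≈-trans (*-identityˡ _) (𝟙↑ n)

  K : PS
  K = b ↑ 3 ⊛ i ↑ 3

  -- This is `a³b³≈` divided by a¹². K⁴ is written as an iterated square, the form in which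
  -- `square-even` reads coefficients.
  b³i⁹≈ : b ↑ 3 ⊛ i ↑ 9 ≈ 𝟙 ⊕ q ⊛ (K ↑ 2) ↑ 2
  b³i⁹≈ = begin
    b ↑ 3 ⊛ i ↑ 9              ≈⟨ pad 3 _ ⟩
    b ↑ 3 ⊛ i ↑ 9 ⊛ (a ⊛ i) ↑ 3
      ≈⟨ solve 3 (λ a b i → b :^ 3 :* i :^ 9 :* (a :* i) :^ 3 := a :^ 3 :* b :^ 3 :* i :^ 12) ≈-refl a b i ⟩
    a ↑ 3 ⊛ b ↑ 3 ⊛ i ↑ 12     ≈⟨ *-congʳ a³b³≈ ⟩
    (a ↑ 12 ⊕ q ⊛ b ↑ 12) ⊛ i ↑ 12
      ≈⟨ solve 4 (λ q a b i → (a :^ 12 :+ q :* b :^ 12) :* i :^ 12 :=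
                              con 1ℙ :* (a :* i) :^ 12 :+ q :* ((b :^ 3 :* i :^ 3) :^ 2) :^ 2) ≈-refl q a b i ⟩
    𝟙 ⊛ (a ⊛ i) ↑ 12 ⊕ q ⊛ (K ↑ 2) ↑ 2 ≈⟨ +-congʳ (pad 12 𝟙) ⟨
    𝟙 ⊕ q ⊛ (K ↑ 2) ↑ 2 ∎
    where open ≈-Reasoning

  -- This is `a³b³≈` divided by a⁶, a splitting into even and odd exponents. The series b⁶ / a³ is
  -- written b⁶ i⁶ a³, so that only the first term calls for a cancellation.
  K≈ : K ≈ (a ↑ 3) ↑ 2 ⊕ q ⊛ (b ↑ 6 ⊛ i ↑ 6 ⊛ a ↑ 3) ↑ 2
  K≈ = begin
    b ↑ 3 ⊛ i ↑ 3              ≈⟨ pad 9 _ ⟩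
    b ↑ 3 ⊛ i ↑ 3 ⊛ (a ⊛ i) ↑ 9
      ≈⟨ solve 3 (λ a b i → b :^ 3 :* i :^ 3 :* (a :* i) :^ 9 := a :^ 3 :* b :^ 3 :* (a :^ 6 :* i :^ 12)) ≈-refl a b i ⟩
    a ↑ 3 ⊛ b ↑ 3 ⊛ (a ↑ 6 ⊛ i ↑ 12)     ≈⟨ *-congʳ a³b³≈ ⟩
    (a ↑ 12 ⊕ q ⊛ b ↑ 12) ⊛ (a ↑ 6 ⊛ i ↑ 12)
      ≈⟨ solve 4 (λ q a b i → (a :^ 12 :+ q :* b :^ 12) :* (a :^ 6 :* i :^ 12) :=
           (a :^ 3) :^ 2 :* (a :* i) :^ 12 :+ q :* (b :^ 6 :* i :^ 6 :* a :^ 3) :^ 2) ≈-refl q a b i ⟩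
    (a ↑ 3) ↑ 2 ⊛ (a ⊛ i) ↑ 12 ⊕ q ⊛ (b ↑ 6 ⊛ i ↑ 6 ⊛ a ↑ 3) ↑ 2 ≈⟨ +-congʳ (pad 12 _) ⟨
    (a ↑ 3) ↑ 2 ⊕ q ⊛ (b ↑ 6 ⊛ i ↑ 6 ⊛ a ↑ 3) ↑ 2 ∎
    where open ≈-Reasoning

  -- a³ / b⁹
  quotient : PS
  quotient = triple (a ⊛ i ↑ 9) ⊕ q ⊛ triple (b ↑ 3 ⊛ i ↑ 9)

  bj≈𝟙 : b ⊛ triple i ≈ 𝟙
  bj≈𝟙 = ≈-trans (≈-sym (triple-⊛ a i)) (≈-trans (triple-cong ai≈𝟙) (triple-const 1ℙ))

  -- Since b⁹ is a series in q³, dividing a³ = b + q c³ by it keeps the exponents 0 and 1 modulo 3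
  -- apart.
  quotient≈ : quotient ≈ a ↑ 3 ⊛ triple i ↑ 9
  quotient≈ = begin
    triple (a ⊛ i ↑ 9) ⊕ q ⊛ triple (b ↑ 3 ⊛ i ↑ 9)
      ≈⟨ +-cong (≈-trans (triple-⊛ a (i ↑ 9)) (*-congˡ (triple-↑ i 9)))
                (*-congˡ (≈-trans (triple-⊛ (b ↑ 3) (i ↑ 9)) (*-cong (triple-↑ b 3) (triple-↑ i 9)))) ⟩
    b ⊛ triple i ↑ 9 ⊕ q ⊛ (c ↑ 3 ⊛ triple i ↑ 9)
      ≈⟨ solve 4 (λ q b c j → b :* j :+ q :* (c :* j) := (b :+ q :* c) :* j) ≈-refl q b (c ↑ 3) (triple i ↑ 9) ⟩
    (b ⊕ q ⊛ c ↑ 3) ⊛ triple i ↑ 9 ≈⟨ *-congʳ a³≈ ⟨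
    a ↑ 3 ⊛ triple i ↑ 9 ∎
    where open ≈-Reasoning

  -- The leading 1 comes from F = q (j₆ + 3). The index 8r is written `r * 2 * 2 * 2`, one factor
  -- for each use of `square-even`.
  quotient-at : ∀ r → quotient (1 + (1 + r * 2 * 2 * 2) * 3) ≡ (a ↑ 3) r
  quotient-at r = begin
    quotient (1 + (1 + m * 2 * 2) * 3)
      ≡⟨ cong₂ _+ₚ_ (triple-1+3n (a ⊛ i ↑ 9) (1 + m * 2 * 2)) (at (q⊛≈shift (triple (b ↑ 3 ⊛ i ↑ 9))) (1 + (1 + m * 2 * 2) * 3)) ⟩
    triple (b ↑ 3 ⊛ i ↑ 9) ((1 + m * 2 * 2) * 3)
      ≡⟨ triple-3n (b ↑ 3 ⊛ i ↑ 9) (1 + m * 2 * 2) ⟩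
    (b ↑ 3 ⊛ i ↑ 9) (1 + m * 2 * 2) ≡⟨ at b³i⁹≈ (1 + m * 2 * 2) ⟩
    (q ⊛ (K ↑ 2) ↑ 2) (1 + m * 2 * 2)   ≡⟨ at (q⊛≈shift ((K ↑ 2) ↑ 2)) (1 + m * 2 * 2) ⟩
    ((K ↑ 2) ↑ 2) (m * 2 * 2)           ≡⟨ square-even (K ↑ 2) (m * 2) ⟩
    (K ↑ 2) (m * 2)                     ≡⟨ square-even K m ⟩
    K m                                 ≡⟨ at K≈ m ⟩
    ((a ↑ 3) ↑ 2) m +ₚ (q ⊛ L ↑ 2) m    ≡⟨ cong₂ _+ₚ_ (square-even (a ↑ 3) r) (odd-part r) ⟩
    (a ↑ 3) r +ₚ 0ℙ                     ≡⟨ ℙ.+-identityʳ _ ⟩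
    (a ↑ 3) r ∎
    where
    open ≡-Reasoning
    m = r * 2
    L = b ↑ 6 ⊛ i ↑ 6 ⊛ a ↑ 3
    odd-part : ∀ r → (q ⊛ L ↑ 2) (r * 2) ≡ 0ℙ
    odd-part zero    = at (q⊛≈shift (L ↑ 2)) 0
    odd-part (suc r) = trans (at (q⊛≈shift (L ↑ 2)) (2 + r * 2)) (square-odd L r)

-- Triangular numbers

T : ℕ → ℕ
T zero    = 0
T (suc n) = suc n + T n

T+T≡n*[1+n] : ∀ n → T n + T n ≡ n * suc n
T+T≡n*[1+n] zero    = refl
T+T≡n*[1+n] (suc n) = begin
  suc n + T n + (suc n + T n)  ≡⟨ shuffle (T n) n ⟩
  suc n + suc n + (T n + T n)  ≡⟨ cong (λ t → suc n + suc n + t) (T+T≡n*[1+n] n) ⟩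
  suc n + suc n + n * suc n    ≡⟨ solveℕ (n ∷ []) ⟩
  suc n * (2 + n)              ∎
  where
  open ≡-Reasoning
  shuffle : ∀ t n → suc n + t + (suc n + t) ≡ suc n + suc n + (t + t)
  shuffle = solveℕ-∀

n≤T : ∀ n → n ≤ T n
n≤T zero    = z≤n
n≤T (suc n) = ℕ.m≤m+n (suc n) (T n)

T-2n : ∀ n → T (n * 2) ≡ suc (n * 2) * n
T-2n zero    = refl
T-2n (suc n) = trans (cong (λ t → 2 + n * 2 + (suc (n * 2) + t)) (T-2n n)) (solveℕ (n ∷ []))

T-1+3n : ∀ n → T (1 + n * 3) ≡ 1 + T n * 9
T-1+3n zero    = refl
T-1+3n (suc n) = trans
  (cong (λ t → 4 + n * 3 + (3 + n * 3 + (2 + n * 3 + t))) (T-1+3n n)) (regroup n (T n))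
  where
  regroup : ∀ n t → 4 + n * 3 + (3 + n * 3 + (2 + n * 3 + (1 + t * 9))) ≡ 1 + (suc n + t) * 9
  regroup = solveℕ-∀

-- With k = m + 1 these are k(3k - 1)/2 and k(3k + 1)/2, written as the exponents s n + T s of
-- Shanks' sum at s = k, for n = m and n = k.
pentagonal₁ pentagonal₂ : ℕ → ℕ
pentagonal₁ m = suc m * m + T (suc m)
pentagonal₂ m = suc m * suc m + T (suc m)

-- Triangular numbers of index 2 or 0 modulo 3 are three times pentagonal ones; this is how Euler's
-- product in q³ enters ψ.
T-2+3n : ∀ n → T (2 + n * 3) ≡ pentagonal₁ n * 3
T-2+3n n = begin
  2 + n * 3 + T (1 + n * 3)               ≡⟨ cong (λ t → 2 + n * 3 + t) (T-1+3n n) ⟩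
  2 + n * 3 + (1 + T n * 9)               ≡⟨ regroup n (T n) ⟩
  3 + n * 3 + T n * 3 + (T n + T n) * 3   ≡⟨ cong (λ t → 3 + n * 3 + T n * 3 + t * 3) (T+T≡n*[1+n] n) ⟩
  3 + n * 3 + T n * 3 + n * suc n * 3     ≡⟨ collect n (T n) ⟩
  (suc n * n + (suc n + T n)) * 3         ∎
  where
  open ≡-Reasoning
  regroup : ∀ n t → 2 + n * 3 + (1 + t * 9) ≡ 3 + n * 3 + t * 3 + (t + t) * 3
  regroup = solveℕ-∀
  collect : ∀ n t → 3 + n * 3 + t * 3 + n * suc n * 3 ≡ (suc n * n + (suc n + t)) * 3
  collect = solveℕ-∀

T-3+3n : ∀ n → T (3 + n * 3) ≡ pentagonal₂ n * 3
T-3+3n n = trans (cong (λ t → 3 + n * 3 + t) (T-2+3n n)) (regroup n (T (suc n)))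
  where
  regroup : ∀ n t → 3 + n * 3 + (suc n * n + t) * 3 ≡ (suc n * suc n + t) * 3
  regroup = solveℕ-∀

-- Euler's product and the theta series

E : ℕ → PS
E zero    = 𝟙
E (suc n) = (𝟙 ⊕ q ↑ suc n) ⊛ E n

Ψ : ℕ → PS
Ψ zero    = 𝟘
Ψ (suc n) = Ψ n ⊕ q ↑ T n

P : ℕ → PS
P zero    = 𝟙
P (suc n) = P n ⊕ q ↑ pentagonal₁ n ⊕ q ↑ pentagonal₂ n

-- One coefficient better than the Cauchy condition: N factors already give the coefficient at N,
-- which is what `Fcoef` relies on.
E-suc≈[] : ∀ n → E (suc n) ≈[ suc n ] E n
E-suc≈[] n = ≈[]-trans (⊛-cong[] (⊕≈[] 𝟙 ℕ.≤-refl) (≈[]-refl {E n})) (≈⇒≈[] (*-identityˡ (E n)))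

E-cauchy : ∀ n → E (suc n) ≈[ n ] E n
E-cauchy n = ≈[]-weaken (ℕ.n≤1+n n) (E-suc≈[] n)

Ψ-cauchy : ∀ n → Ψ (suc n) ≈[ n ] Ψ n
Ψ-cauchy n = ⊕≈[] (Ψ n) (n≤T n)

euler ψ : PS
euler = lim E
ψ = lim Ψ

E₀≡1 : ∀ n → E n 0 ≡ 1ℙ
E₀≡1 zero    = refl
E₀≡1 (suc n) = E₀≡1 n

-- Shanks' proof of Euler's pentagonal number theorem

1/E : ℕ → PS
1/E zero    = 𝟙
1/E (suc n) = inverse (𝟙 ⊕ q ↑ suc n) ⊛ 1/E n

1/E-suc : ∀ n → (𝟙 ⊕ q ↑ suc n) ⊛ 1/E (suc n) ≈ 1/E n
1/E-suc n = ≈-trans (≈-sym (*-assoc u (inverse u) (1/E n)))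
  (≈-trans (*-congʳ (⊛-inverseʳ u refl)) (*-identityˡ (1/E n)))
  where u = 𝟙 ⊕ q ↑ suc n

1/E⊛E : ∀ n → 1/E n ⊛ E n ≈ 𝟙
1/E⊛E zero    = *-identityˡ 𝟙
1/E⊛E (suc n) = begin
  1/E (suc n) ⊛ (u ⊛ E n)  ≈⟨ solve 3 (λ v u e → v :* (u :* e) := u :* v :* e) ≈-refl (1/E (suc n)) u (E n) ⟩
  u ⊛ 1/E (suc n) ⊛ E n    ≈⟨ *-congʳ (1/E-suc n) ⟩
  1/E n ⊛ E n              ≈⟨ 1/E⊛E n ⟩
  𝟙                        ∎
  where
  open ≈-Reasoning
  u = 𝟙 ⊕ q ↑ suc n

-- Shanks' sum of (E n / E s) q^(s n + T s), divided by E n and cut off at an independent bound so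
-- that it can telescope.
pentagonalSum : ℕ → ℕ → PS
pentagonalSum n zero    = 𝟘
pentagonalSum n (suc s) = pentagonalSum n s ⊕ 1/E s ⊛ (q ↑ (s * n + T s))

q↑-+ : ∀ {k} m n → k ≡ m + n → q ↑ k ≈ q ↑ m ⊛ q ↑ n
q↑-+ m n refl = ^-homo-* q m n

-- The terms telescope in s. The boundary term carries 1 + q^s, which cancels the last factor of
-- `1/E s` and is 0 modulo 2 at s = 0, where the induction starts.
pentagonalSum-telescope : ∀ m s →
  (𝟙 ⊕ q ↑ suc m) ⊛ pentagonalSum (suc m) s ⊕ pentagonalSum m s
    ≈ (𝟙 ⊕ q ↑ s) ⊛ 1/E s ⊛ (q ↑ (s * m + T s))
pentagonalSum-telescope m zero = solve 1
  (λ u → u :* con 0ℙ :+ con 0ℙ := (con 1ℙ :+ con 1ℙ) :* con 1ℙ :* con 1ℙ) ≈-refl (𝟙 ⊕ q ↑ suc m)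
pentagonalSum-telescope m (suc s) = begin
  (𝟙 ⊕ Q) ⊛ (C′ ⊕ v ⊛ (q ↑ (s * suc m + T s))) ⊕ (C ⊕ v ⊛ X)
    ≈⟨ +-congʳ (*-congˡ (⊕-congˡ C′ (*-congˡ (q↑-+ s (s * m + T s) (expand s m (T s)))))) ⟩
  (𝟙 ⊕ Q) ⊛ (C′ ⊕ v ⊛ (Y ⊛ X)) ⊕ (C ⊕ v ⊛ X)
    ≈⟨ solve 6 (λ Q C′ C v Y X →
         (con 1ℙ :+ Q) :* (C′ :+ v :* (Y :* X)) :+ (C :+ v :* X) :=
         ((con 1ℙ :+ Q) :* C′ :+ C) :+ (v :* X :+ v :* (Y :* X) :+ Q :* (v :* (Y :* X)))) ≈-refl Q C′ C v Y X ⟩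
  ((𝟙 ⊕ Q) ⊛ C′ ⊕ C) ⊕ (v ⊛ X ⊕ v ⊛ (Y ⊛ X) ⊕ Q ⊛ (v ⊛ (Y ⊛ X)))
    ≈⟨ +-congʳ (pentagonalSum-telescope m s) ⟩
  (𝟙 ⊕ Y) ⊛ v ⊛ X ⊕ (v ⊛ X ⊕ v ⊛ (Y ⊛ X) ⊕ Q ⊛ (v ⊛ (Y ⊛ X)))
    ≈⟨ solve 4 (λ Q v Y X →
         (con 1ℙ :+ Y) :* v :* X :+ (v :* X :+ v :* (Y :* X) :+ Q :* (v :* (Y :* X))) :=
         v :* (Q :* (Y :* X))) ≈-refl Q v Y X ⟩
  v ⊛ (Q ⊛ (Y ⊛ X))
    ≈⟨ *-cong (1/E-suc s) (≈-trans (q↑-+ (suc m) (s + (s * m + T s)) (regroup s m (T s)))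
         (*-congˡ (^-homo-* q s (s * m + T s)))) ⟨
  (𝟙 ⊕ q ↑ suc s) ⊛ 1/E (suc s) ⊛ (q ↑ (suc s * m + T (suc s))) ∎
  where
  open ≈-Reasoning
  Q = q ↑ suc m
  C′ = pentagonalSum (suc m) s
  C = pentagonalSum m s
  v = 1/E s
  Y = q ↑ s
  X = q ↑ (s * m + T s)
  expand : ∀ s m t → s * suc m + t ≡ s + (s * m + t)
  expand = solveℕ-∀
  regroup : ∀ s m t → suc s * m + (suc s + t) ≡ suc m + (s + (s * m + t))
  regroup = solveℕ-∀

P⊛1/E : ∀ n → P n ⊛ 1/E n ≈ pentagonalSum n (suc n)
P⊛1/E zero    = solve 0 (con 1ℙ :* con 1ℙ := con 0ℙ :+ con 1ℙ :* con 1ℙ) ≈-refl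
P⊛1/E (suc m) = ⊛-cancelˡ u refl (begin
  u ⊛ ((P m ⊕ A ⊕ B) ⊛ v′)
    ≈⟨ solve 5 (λ u P A B v → u :* ((P :+ A :+ B) :* v) := (P :+ A :+ B) :* (u :* v)) ≈-refl u (P m) A B v′ ⟩
  (P m ⊕ A ⊕ B) ⊛ (u ⊛ v′)
    ≈⟨ *-congˡ (1/E-suc m) ⟩
  (P m ⊕ A ⊕ B) ⊛ v
    ≈⟨ solve 4 (λ P A B v → (P :+ A :+ B) :* v := P :* v :+ (v :* A :+ v :* B)) ≈-refl (P m) A B v ⟩
  P m ⊛ v ⊕ (v ⊛ A ⊕ v ⊛ B)
    -- Of the two new pentagonal terms, `A` is the boundary term of the telescoping sum and `B` the
    -- new last summand; the two copies of `C` cancel.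
    ≈⟨ +-cong (P⊛1/E m) (+-cong (≈-trans (*-congʳ (≈-sym (1/E-suc m))) (≈-sym (pentagonalSum-telescope m (suc m))))
                                (*-congʳ (≈-sym (1/E-suc m)))) ⟩
  C ⊕ (u ⊛ C′ ⊕ C ⊕ u ⊛ v′ ⊛ B)
    ≈⟨ solve 5 (λ u C C′ v B → C :+ (u :* C′ :+ C :+ u :* v :* B) := u :* (C′ :+ v :* B)) ≈-refl u C C′ v′ B ⟩
  u ⊛ (C′ ⊕ v′ ⊛ B) ∎)
  where
  open ≈-Reasoning
  u = 𝟙 ⊕ q ↑ suc m
  v = 1/E m
  v′ = 1/E (suc m)
  A = q ↑ pentagonal₁ m
  B = q ↑ pentagonal₂ m
  C = pentagonalSum m (suc m)
  C′ = pentagonalSum (suc m) (suc m)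

pentagonalSum≈[]𝟙 : ∀ n s → pentagonalSum n (suc s) ≈[ n ] 𝟙
pentagonalSum≈[]𝟙 n zero    = ≈⇒≈[] (solve 0 (con 0ℙ :+ con 1ℙ :* con 1ℙ := con 1ℙ) ≈-refl)
pentagonalSum≈[]𝟙 n (suc s) = ≈[]-trans
  (⊕-cong[] (pentagonalSum≈[]𝟙 n s) (⊛-congˡ[] (1/E (suc s)) (≈[]-weaken n≤ (q↑≈[]𝟘 (suc s * n + T (suc s))))))
  (≈⇒≈[] (solve 1 (λ v → con 1ℙ :+ v :* con 0ℙ := con 1ℙ) ≈-refl (1/E (suc s))))
  where
  n≤ : n ≤ suc s * n + T (suc s)
  n≤ = ℕ.≤-trans (ℕ.m≤m+n n (s * n)) (ℕ.m≤m+n (suc s * n) (T (suc s)))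

-- In Shanks' identity every summand with s ≥ 1 is divisible by q^n, so that only the summand 1
-- survives.
P≈[]E : ∀ n → P n ≈[ n ] E n
P≈[]E n = ≈[]-trans (≈⇒≈[] (begin
    P n                  ≈⟨ *-identityʳ (P n) ⟨
    P n ⊛ 𝟙              ≈⟨ *-congˡ (1/E⊛E n) ⟨
    P n ⊛ (1/E n ⊛ E n)  ≈⟨ *-assoc (P n) (1/E n) (E n) ⟨
    P n ⊛ 1/E n ⊛ E n    ≈⟨ *-congʳ (P⊛1/E n) ⟩
    pentagonalSum n (suc n) ⊛ E n ∎))
  (≈[]-trans (⊛-cong[] (pentagonalSum≈[]𝟙 n n) (≈[]-refl {E n})) (≈⇒≈[] (*-identityˡ (E n))))
  where open ≈-Reasoning

-- Shanks' proof of Gauss' theorem on triangular numbers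

-- As a power of q², so that `q² (suc n)` unfolds to `q ↑ 2 ⊛ q² n` for the solver.
q² : ℕ → PS
q² n = (q ↑ 2) ↑ n

q²≈q↑2n : ∀ n → q² n ≈ q ↑ (n * 2)
q²≈q↑2n n = ≈-trans (^-assocʳ q 2 n) (^-congʳ q (ℕ.*-comm 2 n))

-- w s is the product of (1 − q^(2r−1)) / (1 − q^(2r)) over 1 ≤ r ≤ s
w : ℕ → PS
w zero    = 𝟙
w (suc s) = inverse (𝟙 ⊕ q² (suc s)) ⊛ ((𝟙 ⊕ q ⊛ q² s) ⊛ w s)

w-suc : ∀ s → (𝟙 ⊕ q² (suc s)) ⊛ w (suc s) ≈ (𝟙 ⊕ q ⊛ q² s) ⊛ w s
w-suc s = ≈-trans (≈-sym (*-assoc u (inverse u) _))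
  (≈-trans (*-congʳ (⊛-inverseʳ u refl)) (*-identityˡ _))
  where u = 𝟙 ⊕ q² (suc s)

-- Shanks' sum of (w s / w n) q^(s(2n+1)), multiplied by w n; again the upper bound is independent
-- of n.
triangularSum : ℕ → ℕ → PS
triangularSum n zero    = 𝟘
triangularSum n (suc s) = triangularSum n s ⊕ w s ⊛ (q ⊛ q² n) ↑ s

shifted-power : ∀ m s → (q ⊛ q² (suc m)) ↑ s ≈ q² s ⊛ (q ⊛ q² m) ↑ s
shifted-power m s = ≈-trans
  (^-congˡ s (solve 2 (λ q y → q :* (q :^ 2 :* y) := q :^ 2 :* (q :* y)) ≈-refl q (q² m)))
  (^-distrib-* (q ↑ 2) (q ⊛ q² m) s)

-- As in the pentagonal case, the boundary factor 1 + q^(2s) vanishes modulo 2 at s = 0.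
triangularSum-telescope : ∀ m s →
  (𝟙 ⊕ q² (suc m)) ⊛ triangularSum (suc m) s ⊕ (𝟙 ⊕ q ⊛ q² m) ⊛ triangularSum m s
    ≈ (𝟙 ⊕ q² s) ⊛ w s ⊛ (q ⊛ q² m) ↑ s
triangularSum-telescope m zero = solve 2
  (λ u v → u :* con 0ℙ :+ v :* con 0ℙ := (con 1ℙ :+ con 1ℙ) :* con 1ℙ :* con 1ℙ)
  ≈-refl (𝟙 ⊕ q² (suc m)) (𝟙 ⊕ q ⊛ q² m)
triangularSum-telescope m (suc s) = begin
  (𝟙 ⊕ q² (suc m)) ⊛ (D′ ⊕ w s ⊛ (q ⊛ q² (suc m)) ↑ s) ⊕ (𝟙 ⊕ q ⊛ q² m) ⊛ (D ⊕ w s ⊛ X)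
    ≈⟨ +-congʳ (*-congˡ (⊕-congˡ D′ (*-congˡ (shifted-power m s)))) ⟩
  (𝟙 ⊕ q² (suc m)) ⊛ (D′ ⊕ w s ⊛ (q² s ⊛ X)) ⊕ (𝟙 ⊕ q ⊛ q² m) ⊛ (D ⊕ w s ⊛ X)
    ≈⟨ solve 7 (λ q y z D D′ w X →
         (con 1ℙ :+ q :^ 2 :* y) :* (D′ :+ w :* (z :* X)) :+ (con 1ℙ :+ q :* y) :* (D :+ w :* X) :=
         ((con 1ℙ :+ q :^ 2 :* y) :* D′ :+ (con 1ℙ :+ q :* y) :* D) :+
         ((con 1ℙ :+ z) :* w :* X :+ (con 1ℙ :+ q :* z) :* w :* (q :* y :* X)))
         ≈-refl q (q² m) (q² s) D D′ (w s) X ⟩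
  ((𝟙 ⊕ q² (suc m)) ⊛ D′ ⊕ (𝟙 ⊕ q ⊛ q² m) ⊛ D) ⊕
  ((𝟙 ⊕ q² s) ⊛ w s ⊛ X ⊕ (𝟙 ⊕ q ⊛ q² s) ⊛ w s ⊛ (q ⊛ q² m ⊛ X))
    ≈⟨ +-cong (triangularSum-telescope m s) (⊕-congˡ ((𝟙 ⊕ q² s) ⊛ w s ⊛ X) (*-congʳ (≈-sym (w-suc s)))) ⟩
  (𝟙 ⊕ q² s) ⊛ w s ⊛ X ⊕ ((𝟙 ⊕ q² s) ⊛ w s ⊛ X ⊕ (𝟙 ⊕ q² (suc s)) ⊛ w (suc s) ⊛ (q ⊛ q² m ⊛ X))
    ≈⟨ solve 2 (λ x y → x :+ (x :+ y) := y) ≈-refl ((𝟙 ⊕ q² s) ⊛ w s ⊛ X) _ ⟩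
  (𝟙 ⊕ q² (suc s)) ⊛ w (suc s) ⊛ (q ⊛ q² m) ↑ suc s ∎
  where
  open ≈-Reasoning
  D′ = triangularSum (suc m) s
  D = triangularSum m s
  X = (q ⊛ q² m) ↑ s

q↑T-2n : ∀ n → q ↑ T (n * 2) ≈ (q ⊛ q² n) ↑ n
q↑T-2n n = begin
  q ↑ T (n * 2)            ≡⟨ cong (q ↑_) (T-2n n) ⟩
  q ↑ (suc (n * 2) * n)    ≈⟨ ^-assocʳ q (suc (n * 2)) n ⟨
  (q ⊛ q ↑ (n * 2)) ↑ n    ≈⟨ ^-congˡ n (*-congˡ {q} (q²≈q↑2n n)) ⟨
  (q ⊛ q² n) ↑ n           ∎
  where open ≈-Reasoning

q↑T-1+2n : ∀ n → q ↑ T (1 + n * 2) ≈ q ⊛ q² n ⊛ (q ⊛ q² n) ↑ n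
q↑T-1+2n n = ≈-trans (^-homo-* q (1 + n * 2) (T (n * 2)))
  (*-cong (*-congˡ {q} (≈-sym (q²≈q↑2n n))) (q↑T-2n n))

w⊛Ψ : ∀ n → w n ⊛ Ψ (n * 2) ≈ triangularSum n n
w⊛Ψ zero    = zeroʳ 𝟙
w⊛Ψ (suc m) = ⊛-cancelˡ u refl (begin
  u ⊛ (w (suc m) ⊛ (Ψ (m * 2) ⊕ q ↑ T (m * 2) ⊕ q ↑ T (1 + m * 2)))
    ≈⟨ *-assoc u (w (suc m)) _ ⟨
  u ⊛ w (suc m) ⊛ (Ψ (m * 2) ⊕ q ↑ T (m * 2) ⊕ q ↑ T (1 + m * 2))
    ≈⟨ *-cong (w-suc m) (+-cong (⊕-congˡ (Ψ (m * 2)) (q↑T-2n m)) (q↑T-1+2n m)) ⟩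
  (𝟙 ⊕ q ⊛ y) ⊛ w m ⊛ (Ψ (m * 2) ⊕ X ⊕ q ⊛ y ⊛ X)
    ≈⟨ solve 5 (λ q y w Ψ X →
         (con 1ℙ :+ q :* y) :* w :* (Ψ :+ X :+ q :* y :* X) :=
         (con 1ℙ :+ q :* y) :* (w :* Ψ) :+ (con 1ℙ :+ (q :* y) :^ 2) :* (w :* X)) ≈-refl q y (w m) (Ψ (m * 2)) X ⟩
  (𝟙 ⊕ q ⊛ y) ⊛ (w m ⊛ Ψ (m * 2)) ⊕ (𝟙 ⊕ (q ⊛ y) ↑ 2) ⊛ (w m ⊛ X)
    ≈⟨ +-congʳ (*-congˡ (w⊛Ψ m)) ⟩
  (𝟙 ⊕ q ⊛ y) ⊛ D ⊕ (𝟙 ⊕ (q ⊛ y) ↑ 2) ⊛ (w m ⊛ X)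
    -- 1 + (q y)² = (1 + y) + y (1 + q² y): the first part is the boundary term at s = m, the second
    -- gives the new summand.
    ≈⟨ solve 5 (λ q y w X D →
         (con 1ℙ :+ q :* y) :* D :+ (con 1ℙ :+ (q :* y) :^ 2) :* (w :* X) :=
         (con 1ℙ :+ q :* y) :* D :+ (con 1ℙ :+ y) :* w :* X :+
         (con 1ℙ :+ q :^ 2 :* y) :* (w :* (y :* X))) ≈-refl q y (w m) X D ⟩
  (𝟙 ⊕ q ⊛ y) ⊛ D ⊕ (𝟙 ⊕ y) ⊛ w m ⊛ X ⊕ u ⊛ (w m ⊛ (y ⊛ X))
    ≈⟨ +-cong (⊕-congˡ ((𝟙 ⊕ q ⊛ y) ⊛ D) (≈-sym (triangularSum-telescope m m)))
              (*-congˡ (*-congˡ (≈-sym (shifted-power m m)))) ⟩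
  (𝟙 ⊕ q ⊛ y) ⊛ D ⊕ (u ⊛ D′ ⊕ (𝟙 ⊕ q ⊛ y) ⊛ D) ⊕ u ⊛ (w m ⊛ X′)
    ≈⟨ solve 4 (λ d u D′ z → d :+ (u :* D′ :+ d) :+ u :* z := u :* (D′ :+ z))
         ≈-refl ((𝟙 ⊕ q ⊛ y) ⊛ D) u D′ (w m ⊛ X′) ⟩
  u ⊛ (D′ ⊕ w m ⊛ X′) ∎)
  where
  open ≈-Reasoning
  u = 𝟙 ⊕ q² (suc m)
  y = q² m
  X = (q ⊛ q² m) ↑ m
  X′ = (q ⊛ q² (suc m)) ↑ m
  D = triangularSum m m
  D′ = triangularSum (suc m) m

triangularSum≈[]𝟙 : ∀ n s → triangularSum n (suc s) ≈[ n ] 𝟙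
triangularSum≈[]𝟙 n zero    = ≈⇒≈[] (solve 0 (con 0ℙ :+ con 1ℙ :* con 1ℙ := con 1ℙ) ≈-refl)
triangularSum≈[]𝟙 n (suc s) = ≈[]-trans
  (⊕-cong[] (triangularSum≈[]𝟙 n s)
    (⊛-congˡ[] (w (suc s)) (⊛-cong[] (⊛-congˡ[] q q²≈[]𝟘) (≈[]-refl {(q ⊛ q² n) ↑ s}))))
  (≈⇒≈[] (solve 3 (λ w q x → con 1ℙ :+ w :* (q :* con 0ℙ :* x) := con 1ℙ) ≈-refl (w (suc s)) q ((q ⊛ q² n) ↑ s)))
  where
  q²≈[]𝟘 : q² n ≈[ n ] 𝟘
  q²≈[]𝟘 = ≈[]-trans (≈⇒≈[] (q²≈q↑2n n)) (≈[]-weaken (ℕ.m≤m*n n 2) (q↑≈[]𝟘 (n * 2)))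

w⊛Ψ≈[]𝟙 : ∀ n → w n ⊛ Ψ (n * 2) ≈[ n ] 𝟙
w⊛Ψ≈[]𝟙 zero    = below λ _ ()
w⊛Ψ≈[]𝟙 (suc m) = ≈[]-trans (≈⇒≈[] (w⊛Ψ (suc m))) (triangularSum≈[]𝟙 (suc m) m)

-- Modulo 2, (1 + q^r)⁴ = (1 + q^(2r))²: one factor cancels the denominator of w, the other supplies
-- the even factors of E(2n).
w⊛E⁴ : ∀ n → w n ⊛ E n ↑ 4 ≈ E (n * 2)
w⊛E⁴ zero    = solve 0 (con 1ℙ :* con 1ℙ :^ 4 := con 1ℙ) ≈-refl
w⊛E⁴ (suc n) = begin
  w (suc n) ⊛ ((𝟙 ⊕ q ⊛ z) ⊛ E n) ↑ 4
    ≈⟨ solve 4 (λ w q z e → w :* ((con 1ℙ :+ q :* z) :* e) :^ 4 :=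
                 (con 1ℙ :+ q :^ 2 :* z :^ 2) :* w :* ((con 1ℙ :+ q :^ 2 :* z :^ 2) :* e :^ 4))
         ≈-refl (w (suc n)) q z (E n) ⟩
  (𝟙 ⊕ q ↑ 2 ⊛ z ↑ 2) ⊛ w (suc n) ⊛ ((𝟙 ⊕ q ↑ 2 ⊛ z ↑ 2) ⊛ E n ↑ 4)
    ≈⟨ *-cong (*-congʳ (⊕-congˡ 𝟙 (*-congˡ z²≈))) (*-congʳ (⊕-congˡ 𝟙 (*-congˡ z²≈))) ⟩
  (𝟙 ⊕ q² (suc n)) ⊛ w (suc n) ⊛ ((𝟙 ⊕ q² (suc n)) ⊛ E n ↑ 4)
    ≈⟨ *-congʳ (w-suc n) ⟩
  (𝟙 ⊕ q ⊛ y) ⊛ w n ⊛ ((𝟙 ⊕ q ↑ 2 ⊛ y) ⊛ E n ↑ 4)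
    ≈⟨ solve 4 (λ q y w e → (con 1ℙ :+ q :* y) :* w :* ((con 1ℙ :+ q :^ 2 :* y) :* e) :=
         (con 1ℙ :+ q :* (q :* y)) :* ((con 1ℙ :+ q :* y) :* (w :* e))) ≈-refl q y (w n) (E n ↑ 4) ⟩
  (𝟙 ⊕ q ⊛ (q ⊛ y)) ⊛ ((𝟙 ⊕ q ⊛ y) ⊛ (w n ⊛ E n ↑ 4))
    ≈⟨ *-cong (⊕-congˡ 𝟙 (*-congˡ (*-congˡ (q²≈q↑2n n))))
              (*-cong (⊕-congˡ 𝟙 (*-congˡ (q²≈q↑2n n))) (w⊛E⁴ n)) ⟩
  (𝟙 ⊕ q ⊛ (q ⊛ q ↑ (n * 2))) ⊛ ((𝟙 ⊕ q ⊛ q ↑ (n * 2)) ⊛ E (n * 2)) ∎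
  where
  open ≈-Reasoning
  y = q² n
  z = q ↑ n
  z²≈ : z ↑ 2 ≈ q² n
  z²≈ = ≈-trans (^-assocʳ q n 2) (≈-sym (q²≈q↑2n n))

E⊛Ψ≈[]E⁴ : ∀ n → E (n * 2) ⊛ Ψ (n * 2) ≈[ n ] E n ↑ 4
E⊛Ψ≈[]E⁴ n = ≈[]-trans
  (≈⇒≈[] (≈-trans (*-congʳ (≈-sym (w⊛E⁴ n)))
    (solve 3 (λ w e p → w :* e :* p := w :* p :* e) ≈-refl (w n) (E n ↑ 4) (Ψ (n * 2)))))
  (≈[]-trans (⊛-cong[] (w⊛Ψ≈[]𝟙 n) (≈[]-refl {E n ↑ 4})) (≈⇒≈[] (*-identityˡ (E n ↑ 4))))

euler≈[] : ∀ n → euler ≈[ n ] E n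
euler≈[] = lim≈[] E E-cauchy

-- In the limit the finite identities say f ψ = f⁴, from which f is cancelled.
euler³≈ψ : euler ↑ 3 ≈ ψ
euler³≈ψ = ⊛-cancelˡ euler refl (≈[]⇒≈ λ n → ≈[]-trans (↑-cong[] 4 (euler≈[] n))
  (≈[]-trans (≈[]-sym (E⊛Ψ≈[]E⁴ n)) (≈[]-sym (≈[]-weaken (ℕ.m≤m*n n 2)
    (⊛-cong[] (euler≈[] (n * 2)) (lim≈[] Ψ Ψ-cauchy (n * 2)))))))

-- 3-dissection

triple-q↑ : ∀ {k} n → k ≡ n * 3 → triple (q ↑ n) ≈ q ↑ k
triple-q↑ n refl = begin
  triple (q ↑ n)   ≈⟨ triple-↑ q n ⟩
  triple q ↑ n     ≈⟨ ^-congˡ n triple-q ⟩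
  (q ↑ 3) ↑ n      ≈⟨ ^-assocʳ q 3 n ⟩
  q ↑ (3 * n)      ≡⟨ cong (q ↑_) (ℕ.*-comm 3 n) ⟩
  q ↑ (n * 3)      ∎
  where open ≈-Reasoning

-- T 0 gives the 1 of `P 0`. Each further block of three indices gives one exponent 1 + 9 T n and
-- two tripled pentagonal numbers.
Ψ-dissection : ∀ n → Ψ (1 + n * 3) ≈ triple (P n) ⊕ q ⊛ triple (triple (Ψ n))
Ψ-dissection zero    = begin
  𝟘 ⊕ 𝟙  ≈⟨ solve 1 (λ q → con 0ℙ :+ con 1ℙ := con 1ℙ :+ q :* con 0ℙ) ≈-refl q ⟩
  𝟙 ⊕ q ⊛ 𝟘  ≈⟨ +-cong (triple-const 1ℙ) (*-congˡ 𝟘-triples) ⟨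
  triple 𝟙 ⊕ q ⊛ triple (triple 𝟘) ∎
  where
  open ≈-Reasoning
  𝟘-triples : triple (triple 𝟘) ≈ 𝟘
  𝟘-triples = ≈-trans (triple-cong (pointwise triple-𝟘-at)) (pointwise triple-𝟘-at)
Ψ-dissection (suc n) = begin
  Ψ (1 + n * 3) ⊕ q ↑ T (1 + n * 3) ⊕ q ↑ T (2 + n * 3) ⊕ q ↑ T (3 + n * 3)
    ≈⟨ +-cong (+-cong (+-cong (Ψ-dissection n) nine) (≈-sym (triple-q↑ (pentagonal₁ n) (T-2+3n n))))
              (≈-sym (triple-q↑ (pentagonal₂ n) (T-3+3n n))) ⟩
  triple (P n) ⊕ q ⊛ V ⊕ q ⊛ W ⊕ A ⊕ B
    ≈⟨ solve 6 (λ p q V W A B → p :+ q :* V :+ q :* W :+ A :+ B := p :+ A :+ B :+ q :* (V :+ W))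
         ≈-refl (triple (P n)) q V W A B ⟩
  triple (P n) ⊕ A ⊕ B ⊕ q ⊛ (V ⊕ W)
    ≈⟨ +-cong (≈-trans (triple-⊕ (P n ⊕ q ↑ pentagonal₁ n) (q ↑ pentagonal₂ n)) (+-congʳ (triple-⊕ (P n) (q ↑ pentagonal₁ n))))
         (*-congˡ (≈-trans (triple-cong (triple-⊕ (Ψ n) (q ↑ T n))) (triple-⊕ (triple (Ψ n)) (triple (q ↑ T n))))) ⟨
  triple (P (suc n)) ⊕ q ⊛ triple (triple (Ψ (suc n))) ∎
  where
  open ≈-Reasoning
  V = triple (triple (Ψ n))
  W = triple (triple (q ↑ T n))
  A = triple (q ↑ pentagonal₁ n)
  B = triple (q ↑ pentagonal₂ n)
  nine : q ↑ T (1 + n * 3) ≈ q ⊛ W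
  nine = ≈-trans (^-congʳ q (T-1+3n n)) (*-congˡ {q} (≈-sym (≈-trans
    (triple-cong (triple-q↑ (T n) refl)) (triple-q↑ (T n * 3) (sym (ℕ.*-assoc (T n) 3 3))))))

ψ-dissection : ψ ≈ triple euler ⊕ q ⊛ triple (triple ψ)
ψ-dissection = ≈[]⇒≈ λ n → ≈[]-trans
  (≈[]-weaken (ℕ.≤-trans (ℕ.m≤m*n n 3) (ℕ.n≤1+n (n * 3))) (lim≈[] Ψ Ψ-cauchy (1 + n * 3)))
  (≈[]-trans (≈⇒≈[] (Ψ-dissection n))
    (≈[]-sym (⊕-cong[] (triple-cong[] (≈[]-trans (euler≈[] n) (≈[]-sym (P≈[]E n))))
      (⊛-congˡ[] q (triple-cong[] (triple-cong[] (lim≈[] Ψ Ψ-cauchy n)))))))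

euler³≈ : euler ↑ 3 ≈ triple euler ⊕ q ⊛ triple (triple euler) ↑ 3
euler³≈ = ≈-trans euler³≈ψ (≈-trans ψ-dissection (⊕-congˡ (triple euler) (*-congˡ (≈-trans
  (triple-cong (triple-cong (≈-sym euler³≈ψ)))
  (≈-trans (triple-cong (triple-↑ euler 3)) (triple-↑ (triple euler) 3))))))

module Euler = Dissection euler refl euler³≈

-- Reduction modulo 2 of the product defining Fcoef

parityℤ : ℤ → Parity
parityℤ x = parity ∣ x ∣

parity-⊖ : ∀ m n → parityℤ (m ⊖ n) ≡ parity m +ₚ parity n
parity-⊖ m       zero    = sym (ℙ.+-identityʳ (parity m))
parity-⊖ zero    (suc n) = refl
parity-⊖ (suc m) (suc n) = begin
  parityℤ (suc m ⊖ suc n)           ≡⟨ cong parityℤ (ℤ.[1+m]⊖[1+n]≡m⊖n m n) ⟩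
  parityℤ (m ⊖ n)                   ≡⟨ parity-⊖ m n ⟩
  parity m +ₚ parity n              ≡⟨ ℙ.+-homo-+ m n ⟨
  parity (2 + (m + n))              ≡⟨ cong (parity ∘ suc) (ℕ.+-suc m n) ⟨
  parity (suc m + suc n)            ≡⟨ ℙ.+-homo-+ (suc m) (suc n) ⟩
  parity (suc m) +ₚ parity (suc n)  ∎
  where open ≡-Reasoning

parityℤ-+ : ∀ x y → parityℤ (x +ᶻ y) ≡ parityℤ x +ₚ parityℤ y
parityℤ-+ (+ m)    (+ n)    = ℙ.+-homo-+ m n
parityℤ-+ (+ m)    -[1+ n ] = parity-⊖ m (suc n)
parityℤ-+ -[1+ m ] (+ n)    = trans (parity-⊖ n (suc m)) (ℙ.+-comm (parity n) _)
parityℤ-+ -[1+ m ] -[1+ n ] =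
  trans (cong (parity ∘ suc) (sym (ℕ.+-suc m n))) (ℙ.+-homo-+ (suc m) (suc n))

parityℤ-- : ∀ x y → parityℤ (x - y) ≡ parityℤ x +ₚ parityℤ y
parityℤ-- x y = trans (parityℤ-+ x (ℤ.- y)) (cong (λ k → parityℤ x +ₚ parity k) (ℤ.∣-i∣≡∣i∣ y))

parity≡0⇒2∣ : ∀ n → parity n ≡ 0ℙ → 2 ∣ n
parity≡0⇒2∣ zero          _  = 2 ∣0
parity≡0⇒2∣ (suc (suc n)) eq = ∣m∣n⇒∣m+n ∣-refl (parity≡0⇒2∣ n eq)

parity≡⇒2∣- : ∀ x y → parityℤ x ≡ parityℤ y → (+ 2) ∣ℤ (x - y)
parity≡⇒2∣- x y x≡y = parity≡0⇒2∣ ∣ x - y ∣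
  (trans (parityℤ-- x y) (trans (cong (_+ₚ parityℤ y) x≡y) (ℙ.p+p≡0ℙ (parityℤ y))))

mod2 : Series → PS
mod2 f n = parityℤ (f n)

1+q↑_ : ℕ → PS
1+q↑ m = 𝟙 ⊕ q ↑ m

mod2-mul1m : ∀ m f → mod2 (mul1m m f) ≈ 1+q↑ m ⊛ mod2 f
mod2-mul1m m f = pointwise λ N → trans (coefficient N) (sym (expand N))
  where
  open ≡-Reasoning
  expand : ∀ N → (1+q↑ m ⊛ mod2 f) N ≡ mod2 f N +ₚ (q ↑ m ⊛ mod2 f) N
  expand N = trans (⊛-distribʳ-at (mod2 f) 𝟙 (q ↑ m) N)
    (cong (_+ₚ (q ↑ m ⊛ mod2 f) N) (⊛-identityˡ-at (mod2 f) N))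
  coefficient : ∀ N → mod2 (mul1m m f) N ≡ mod2 f N +ₚ (q ↑ m ⊛ mod2 f) N
  coefficient N with m ≤ᵇ N | ℕ.≤ᵇ-reflects-≤ m N
  ... | true  | ofʸ m≤N = trans (parityℤ-- (f N) (f (N ∸ m))) (cong (mod2 f N +ₚ_) (begin
    mod2 f (N ∸ m)                       ≡⟨ q↑⊛-at m (mod2 f) (N ∸ m) ⟨
    (q ↑ m ⊛ mod2 f) (m + (N ∸ m))       ≡⟨ cong (q ↑ m ⊛ mod2 f) (ℕ.m+[n∸m]≡n m≤N) ⟩
    (q ↑ m ⊛ mod2 f) N                   ∎))
  ... | false | ofⁿ m≰N = sym (trans
    (cong (mod2 f N +ₚ_) (atBelow (q↑⊛≈[]𝟘 m (mod2 f)) N (ℕ.≰⇒> m≰N)))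
    (ℙ.+-identityʳ (mod2 f N)))

∑ : (ℕ → ℤ) → ℕ → ℤ
∑ g L = foldr _+ᶻ_ (+ 0) (applyUpTo g L)

∑-cong : ∀ {g h} L → (∀ k → g k ≡ h k) → ∑ g L ≡ ∑ h L
∑-cong zero    g≗h = refl
∑-cong (suc L) g≗h = cong₂ _+ᶻ_ (g≗h 0) (∑-cong L (g≗h ∘ suc))

∑-zero : ∀ {g} L → (∀ k → g k ≡ + 0) → ∑ g L ≡ + 0
∑-zero zero    g≗0 = refl
∑-zero (suc L) g≗0 = trans (cong₂ _+ᶻ_ (g≗0 0) (∑-zero L (g≗0 ∘ suc))) refl

∑-truncate : ∀ {g} a d → (∀ k → a ≤ k → g k ≡ + 0) → ∑ g (a + d) ≡ ∑ g a
∑-truncate     zero    d g≗0 = ∑-zero d λ k → g≗0 k z≤n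
∑-truncate {g} (suc a) d g≗0 = cong (g 0 +ᶻ_) (∑-truncate a d λ k a≤k → g≗0 (suc k) (s≤s a≤k))

≤ᵇ-+-cancelˡ : ∀ a b c → (a + b ≤ᵇ a + c) ≡ (b ≤ᵇ c)
≤ᵇ-+-cancelˡ zero    b c = refl
≤ᵇ-+-cancelˡ (suc a) b c = trans (suc-cancel (a + b) (a + c)) (≤ᵇ-+-cancelˡ a b c)
  where
  suc-cancel : ∀ b c → (suc b ≤ᵇ suc c) ≡ (b ≤ᵇ c)
  suc-cancel zero    c = refl
  suc-cancel (suc b) c = refl

module _ (m : ℕ) (f : Series) where

  geometricTerm : ℕ → ℕ → ℤ
  geometricTerm N k = if k * suc m ≤ᵇ N then f (N ∸ k * suc m) else + 0

  div1m≡∑ : ∀ N → div1m m f N ≡ ∑ (geometricTerm N) (suc N)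
  div1m≡∑ N = cong (foldr _+ᶻ_ (+ 0)) (map-upTo (geometricTerm N) (suc N))

  geometricTerm-vanishes : ∀ N k → N < k * suc m → geometricTerm N k ≡ + 0
  geometricTerm-vanishes N k N<km with k * suc m ≤ᵇ N | ℕ.≤ᵇ-reflects-≤ (k * suc m) N
  ... | true  | ofʸ km≤N = contradiction km≤N (ℕ.<⇒≱ N<km)
  ... | false | _        = refl

  geometricTerm-suc : ∀ N k → geometricTerm (suc m + N) (suc k) ≡ geometricTerm N k
  geometricTerm-suc N k = cong₂ (λ b n → if b then f n else + 0)
    (≤ᵇ-+-cancelˡ (suc m) (k * suc m) N) (ℕ.[m+n]∸[m+o]≡n∸o (suc m) N (k * suc m))

  div1m-small : ∀ {N} → N < suc m → div1m m f N ≡ f N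
  div1m-small {N} N<m = begin
    div1m m f N                               ≡⟨ div1m≡∑ N ⟩
    f N +ᶻ ∑ (geometricTerm N ∘ suc) N       ≡⟨ cong (f N +ᶻ_) (∑-zero N λ k →
      geometricTerm-vanishes N (suc k) (ℕ.<-≤-trans N<m (ℕ.m≤m+n (suc m) (k * suc m)))) ⟩
    f N +ᶻ + 0                               ≡⟨ ℤ.+-identityʳ (f N) ⟩
    f N                                       ∎
    where open ≡-Reasoning

  -- The summands k + 1 of this coefficient are the summands k of the coefficient at N; the longer
  -- range adds only zeros.
  div1m-step : ∀ N → div1m m f (suc m + N) ≡ f (suc m + N) +ᶻ div1m m f N
  div1m-step N = trans (div1m≡∑ (suc m + N)) (cong (f (suc m + N) +ᶻ_) (begin
    ∑ (geometricTerm (suc m + N) ∘ suc) (suc m + N) ≡⟨ ∑-cong (suc m + N) (geometricTerm-suc N) ⟩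
    ∑ (geometricTerm N) (suc m + N)                 ≡⟨ cong (∑ (geometricTerm N) ∘ suc) (ℕ.+-comm m N) ⟩
    ∑ (geometricTerm N) (suc N + m)                 ≡⟨ ∑-truncate (suc N) m (λ k N<k →
      geometricTerm-vanishes N k (ℕ.<-≤-trans N<k (ℕ.m≤m*n k (suc m)))) ⟩
    ∑ (geometricTerm N) (suc N)                     ≡⟨ div1m≡∑ N ⟨
    div1m m f N                                     ∎))
    where open ≡-Reasoning

  mul1m-div1m : ∀ N → mul1m (suc m) (div1m m f) N ≡ f N
  mul1m-div1m N with suc m ≤ᵇ N | ℕ.≤ᵇ-reflects-≤ (suc m) N
  ... | false | ofⁿ m≰N = div1m-small (ℕ.≰⇒> m≰N)
  ... | true  | ofʸ m≤N = begin
    div1m m f N - d                           ≡⟨ cong (λ k → div1m m f k - d) (ℕ.m+[n∸m]≡n m≤N) ⟨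
    div1m m f (suc m + (N ∸ suc m)) - d       ≡⟨ cong (_- d) (div1m-step (N ∸ suc m)) ⟩
    f (suc m + (N ∸ suc m)) +ᶻ d - d         ≡⟨ ℤ.+-assoc (f (suc m + (N ∸ suc m))) d (ℤ.- d) ⟩
    f (suc m + (N ∸ suc m)) +ᶻ (d - d)       ≡⟨ cong (f (suc m + (N ∸ suc m)) +ᶻ_) (ℤ.+-inverseʳ d) ⟩
    f (suc m + (N ∸ suc m)) +ᶻ + 0           ≡⟨ ℤ.+-identityʳ _ ⟩
    f (suc m + (N ∸ suc m))                   ≡⟨ cong f (ℕ.m+[n∸m]≡n m≤N) ⟩
    f N                                       ∎
    where
    open ≡-Reasoning
    d = div1m m f (N ∸ suc m)

  mod2-div1m : 1+q↑ suc m ⊛ mod2 (div1m m f) ≈ mod2 f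
  mod2-div1m = ≈-trans (≈-sym (mod2-mul1m (suc m) (div1m m f)))
    (pointwise λ N → cong parityℤ (mul1m-div1m N))

mod2-iter-* : ∀ {u} g → (∀ f → mod2 (g f) ≈ u ⊛ mod2 f) → ∀ r f → mod2 (iter r g f) ≈ u ↑ r ⊛ mod2 f
mod2-iter-* {u} g mul zero    f = ≈-sym (*-identityˡ (mod2 f))
mod2-iter-* {u} g mul (suc r) f = ≈-trans (mul (iter r g f))
  (≈-trans (*-congˡ (mod2-iter-* g mul r f)) (≈-sym (*-assoc u (u ↑ r) (mod2 f))))

mod2-iter-/ : ∀ {u} g → (∀ f → u ⊛ mod2 (g f) ≈ mod2 f) → ∀ r f → u ↑ r ⊛ mod2 (iter r g f) ≈ mod2 f
mod2-iter-/     g div zero    f = *-identityˡ (mod2 f)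
mod2-iter-/ {u} g div (suc r) f = begin
  u ⊛ u ↑ r ⊛ mod2 (g h)    ≈⟨ solve 3 (λ u v h → u :* v :* h := v :* (u :* h)) ≈-refl u (u ↑ r) (mod2 (g h)) ⟩
  u ↑ r ⊛ (u ⊛ mod2 (g h))  ≈⟨ *-congˡ (div h) ⟩
  u ↑ r ⊛ mod2 h            ≈⟨ mod2-iter-/ g div r f ⟩
  mod2 f                    ∎
  where
  open ≈-Reasoning
  h = iter r g f

1+q↑-double : ∀ m → 1+q↑ (m * 2) ≈ (1+q↑ m) ↑ 2
1+q↑-double m = ≈-trans (⊕-congˡ 𝟙 (≈-sym (^-assocʳ q m 2)))
  (solve 1 (λ x → con 1ℙ :+ x :^ 2 := (con 1ℙ :+ x) :^ 2) ≈-refl (q ↑ m))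

-- With u = 1 + q^m and v = 1 + q^(3m) the factor is u⁶ v⁹ / (u³ v¹⁸) = u³ / v⁹. Denominators are
-- multiplied across, so that no inverse appears.
mod2-eta-quotient : ∀ {u v} {M₂ M₃ D₁ D₆ : Series → Series} →
  (∀ f → mod2 (M₂ f) ≈ u ↑ 2 ⊛ mod2 f) → (∀ f → mod2 (M₃ f) ≈ v ⊛ mod2 f) →
  (∀ f → u ⊛ mod2 (D₁ f) ≈ mod2 f) → (∀ f → v ↑ 2 ⊛ mod2 (D₆ f) ≈ mod2 f) →
  ∀ f → mod2 (iter 3 M₂ (iter 9 M₃ (iter 3 D₁ (iter 9 D₆ f)))) ⊛ v ↑ 9 ≈ u ↑ 3 ⊛ mod2 f
mod2-eta-quotient {u} {v} {M₂} {M₃} {D₁} {D₆} mul₂ mul₃ div₁ div₆ f = begin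
  mod2 (iter 3 M₂ g₁) ⊛ v ↑ 9
    ≈⟨ *-congʳ (≈-trans (mod2-iter-* M₂ mul₂ 3 g₁) (*-congˡ (mod2-iter-* M₃ mul₃ 9 g₂))) ⟩
  (u ↑ 2) ↑ 3 ⊛ (v ↑ 9 ⊛ mod2 g₂) ⊛ v ↑ 9
    ≈⟨ solve 3 (λ u v g → (u :^ 2) :^ 3 :* (v :^ 9 :* g) :* v :^ 9 :=
                          u :^ 3 :* ((v :^ 2) :^ 9 :* (u :^ 3 :* g))) ≈-refl u v (mod2 g₂) ⟩
  u ↑ 3 ⊛ ((v ↑ 2) ↑ 9 ⊛ (u ↑ 3 ⊛ mod2 g₂))
    ≈⟨ *-congˡ (≈-trans (*-congˡ (mod2-iter-/ D₁ div₁ 3 g₃)) (mod2-iter-/ D₆ div₆ 9 f)) ⟩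
  u ↑ 3 ⊛ mod2 f ∎
  where
  open ≈-Reasoning
  g₃ = iter 9 D₆ f
  g₂ = iter 3 D₁ g₃
  g₁ = iter 9 M₃ g₂

mod2-factor : ∀ m f → mod2 (factor m f) ⊛ (1+q↑ (3 * suc m)) ↑ 9 ≈ (1+q↑ suc m) ↑ 3 ⊛ mod2 f
mod2-factor m = mod2-eta-quotient
  {M₂ = mul1m (2 * suc m)} {mul1m (3 * suc m)} {div1m m} {div1m (6 * suc m ∸ 1)}
  (λ f → ≈-trans (mod2-mul1m (2 * suc m) f) (*-congʳ (double (suc m) (ℕ.*-comm 2 (suc m)))))
  (mod2-mul1m (3 * suc m))
  (mod2-div1m m)
  (λ f → ≈-trans (*-congʳ (≈-sym (double (3 * suc m) (six m)))) (mod2-div1m (6 * suc m ∸ 1) f))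
  where
  double : ∀ {k} n → k ≡ n * 2 → 1+q↑ k ≈ (1+q↑ n) ↑ 2
  double n refl = 1+q↑-double n
  six : ∀ m → 6 * suc m ≡ 3 * suc m * 2
  six = solveℕ-∀

triple-1+q↑ : ∀ m → triple (1+q↑ m) ≈ 1+q↑ (3 * m)
triple-1+q↑ m = ≈-trans (triple-⊕ 𝟙 (q ↑ m)) (+-cong (triple-const 1ℙ) (triple-q↑ m (ℕ.*-comm 3 m)))

mod2-one : mod2 one ≈ 𝟙
mod2-one = pointwise λ { zero → refl ; (suc _) → refl }

mod2-partialProd : ∀ M → mod2 (partialProd M one) ⊛ triple (E M) ↑ 9 ≈ E M ↑ 3
mod2-partialProd zero = begin
  mod2 one ⊛ triple 𝟙 ↑ 9 ≈⟨ *-cong mod2-one (^-congˡ 9 (triple-const 1ℙ)) ⟩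
  𝟙 ⊛ 𝟙 ↑ 9               ≈⟨ solve 0 (con 1ℙ :* con 1ℙ :^ 9 := con 1ℙ :^ 3) ≈-refl ⟩
  𝟙 ↑ 3                   ∎
  where open ≈-Reasoning
mod2-partialProd (suc M) = begin
  p′ ⊛ triple (u ⊛ E M) ↑ 9
    ≈⟨ *-congˡ (^-congˡ 9 (≈-trans (triple-⊛ u (E M)) (*-congʳ (triple-1+q↑ (suc M))))) ⟩
  p′ ⊛ (v ⊛ triple (E M)) ↑ 9
    ≈⟨ solve 3 (λ p v e → p :* (v :* e) :^ 9 := p :* v :^ 9 :* e :^ 9) ≈-refl p′ v (triple (E M)) ⟩
  p′ ⊛ v ↑ 9 ⊛ triple (E M) ↑ 9
    ≈⟨ *-congʳ (mod2-factor M (partialProd M one)) ⟩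
  u ↑ 3 ⊛ mod2 (partialProd M one) ⊛ triple (E M) ↑ 9
    ≈⟨ *-assoc (u ↑ 3) _ _ ⟩
  u ↑ 3 ⊛ (mod2 (partialProd M one) ⊛ triple (E M) ↑ 9)
    ≈⟨ *-congˡ (mod2-partialProd M) ⟩
  u ↑ 3 ⊛ E M ↑ 3
    ≈⟨ solve 2 (λ u e → u :^ 3 :* e :^ 3 := (u :* e) :^ 3) ≈-refl u (E M) ⟩
  (u ⊛ E M) ↑ 3 ∎
  where
  open ≈-Reasoning
  p′ = mod2 (partialProd (suc M) one)
  u = 1+q↑ suc M
  v = 1+q↑ (3 * suc M)

Fcoef-parity : ∀ N → parityℤ (Fcoef N) ≡ Euler.quotient N
Fcoef-parity N = atBelow p≈[]quotient N ℕ.≤-refl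
  where
  open Euler using (b; i; bj≈𝟙; quotient; quotient≈)
  p = mod2 (partialProd N one)
  euler≈[]E : euler ≈[ suc N ] E N
  euler≈[]E = ≈[]-trans (euler≈[] (suc N)) (E-suc≈[] N)
  p≈ : p ≈ p ⊛ b ↑ 9 ⊛ triple i ↑ 9
  p≈ = begin
    p                        ≈⟨ solve 1 (λ p → p := p :* con 1ℙ :^ 9) ≈-refl p ⟩
    p ⊛ 𝟙 ↑ 9                ≈⟨ *-congˡ (^-congˡ 9 bj≈𝟙) ⟨
    p ⊛ (b ⊛ triple i) ↑ 9   ≈⟨ solve 3 (λ p b j → p :* (b :* j) :^ 9 := p :* b :^ 9 :* j :^ 9) ≈-refl p b (triple i) ⟩
    p ⊛ b ↑ 9 ⊛ triple i ↑ 9 ∎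
    where open ≈-Reasoning
  pb⁹≈[] : p ⊛ b ↑ 9 ≈[ suc N ] euler ↑ 3
  pb⁹≈[] = ≈[]-trans (⊛-congˡ[] p (↑-cong[] 9 (triple-cong[] euler≈[]E)))
    (≈[]-trans (≈⇒≈[] (mod2-partialProd N)) (↑-cong[] 3 (≈[]-sym euler≈[]E)))
  p≈[]quotient : p ≈[ suc N ] quotient
  p≈[]quotient = ≈[]-trans (≈⇒≈[] p≈) (≈[]-trans (⊛-cong[] pb⁹≈[] (≈[]-refl {triple i ↑ 9}))
    (≈⇒≈[] (≈-sym quotient≈)))

J6-parity : ∀ {N} r → N ≡ (1 + r * 2 * 2 * 2) * 3 → parityℤ (J6 N) ≡ ψ r
J6-parity r refl = trans (Fcoef-parity (1 + (1 + r * 2 * 2 * 2) * 3))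
  (trans (Euler.quotient-at r) (at euler³≈ψ r))

-- Coefficients of ψ and odd squares

q↑-diagonal : ∀ n → (q ↑ n) n ≡ 1ℙ
q↑-diagonal zero    = refl
q↑-diagonal (suc n) = trans (at (q⊛≈shift (q ↑ n)) (suc n)) (q↑-diagonal n)

q↑-off-diagonal : ∀ k n → k ≢ n → (q ↑ k) n ≡ 0ℙ
q↑-off-diagonal zero    zero    k≢n = contradiction refl k≢n
q↑-off-diagonal zero    (suc n) k≢n = refl
q↑-off-diagonal (suc k) zero    k≢n = refl
q↑-off-diagonal (suc k) (suc n) k≢n =
  trans (at (q⊛≈shift (q ↑ k)) (suc n)) (q↑-off-diagonal k n (k≢n ∘ cong suc))

T-mono-< : ∀ {s n} → s < n → T s < T n
T-mono-< {s} {suc n} (s≤s s≤n) with ℕ.m≤n⇒m<n∨m≡n s≤n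
... | inj₁ s<n  = ℕ.<-≤-trans (T-mono-< s<n) (ℕ.m≤n+m (T n) (suc n))
... | inj₂ refl = s≤s (ℕ.m≤n+m (T n) n)

Ψ-at-T≥ : ∀ N {s} → N ≤ s → Ψ N (T s) ≡ 0ℙ
Ψ-at-T≥ zero    _   = refl
Ψ-at-T≥ (suc N) N<s = cong₂ _+ₚ_ (Ψ-at-T≥ N (ℕ.<⇒≤ N<s)) (q↑-off-diagonal _ _ (ℕ.<⇒≢ (T-mono-< N<s)))

Ψ-at-T< : ∀ N {s} → s < N → Ψ N (T s) ≡ 1ℙ
Ψ-at-T< (suc N) (s≤s s≤N) with ℕ.m≤n⇒m<n∨m≡n s≤N
... | inj₁ s<N  = cong₂ _+ₚ_ (Ψ-at-T< N s<N) (q↑-off-diagonal _ _ (ℕ.<⇒≢ (T-mono-< s<N) ∘ sym))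
... | inj₂ refl = cong₂ _+ₚ_ (Ψ-at-T≥ N ℕ.≤-refl) (q↑-diagonal (T N))

-- T is strictly increasing, so q^(T s) occurs exactly once and nothing cancels modulo 2.
ψ-at-T : ∀ s → ψ (T s) ≡ 1ℙ
ψ-at-T s = Ψ-at-T< (suc (T s)) (s≤s (n≤T s))

triangular-or-zero : ∀ N r → (∃[ s ] T s ≡ r) ⊎ Ψ N r ≡ 0ℙ
triangular-or-zero zero    r = inj₂ refl
triangular-or-zero (suc N) r with T N ℕ.≟ r | triangular-or-zero N r
... | yes TN≡r | _           = inj₁ (N , TN≡r)
... | no  _    | inj₁ exists = inj₁ exists
... | no  TN≢r | inj₂ zero′  = inj₂ (cong₂ _+ₚ_ zero′ (q↑-off-diagonal (T N) r TN≢r))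

ψ-cong : ∀ {r r′} → (∃[ s ] T s ≡ r → ∃[ s ] T s ≡ r′) → (∃[ s ] T s ≡ r′ → ∃[ s ] T s ≡ r) →
         ψ r ≡ ψ r′
ψ-cong {r} {r′} to from with triangular-or-zero (suc r) r | triangular-or-zero (suc r′) r′
... | inj₂ ψr≡0       | inj₂ ψr′≡0       = trans ψr≡0 (sym ψr′≡0)
... | inj₁ (s , refl) | _                with s′ , refl ← to (s , refl) = trans (ψ-at-T s) (sym (ψ-at-T s′))
... | inj₂ _          | inj₁ (s′ , refl) with s , refl ← from (s′ , refl) = trans (ψ-at-T s) (sym (ψ-at-T s′))

odd-square : ∀ s → (1 + 2 * s) * (1 + 2 * s) ≡ 1 + 8 * T s
odd-square s = begin
  (1 + 2 * s) * (1 + 2 * s) ≡⟨ solveℕ (s ∷ []) ⟩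
  1 + 4 * (s * suc s)       ≡⟨ cong (λ t → 1 + 4 * t) (T+T≡n*[1+n] s) ⟨
  1 + 4 * (T s + T s)       ≡⟨ regroup (T s) ⟩
  1 + 8 * T s               ∎
  where
  open ≡-Reasoning
  regroup : ∀ t → 1 + 4 * (t + t) ≡ 1 + 8 * t
  regroup = solveℕ-∀

even-or-odd : ∀ n → ∃[ s ] (n ≡ 2 * s ⊎ n ≡ 1 + 2 * s)
even-or-odd zero    = 0 , inj₁ refl
even-or-odd (suc n) with even-or-odd n
... | s , inj₁ refl = s , inj₂ refl
... | s , inj₂ refl = suc s , inj₁ (cong suc (sym (ℕ.+-suc s (s + 0))))

-- The root is odd because its square is, and (1 + 2s)² = 1 + 8 T s.
square⇒triangular : ∀ d r → d * d ≡ 1 + 8 * r → ∃[ s ] T s ≡ r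
square⇒triangular d r d²≡ with even-or-odd d
... | s , inj₁ refl = contradiction (trans (factor-2 s) (trans d²≡ (cong suc (ℕ.*-assoc 2 4 r))))
                        (ℕ.even≢odd (s * (2 * s)) (4 * r))
  where
  factor-2 : ∀ s → 2 * (s * (2 * s)) ≡ 2 * s * (2 * s)
  factor-2 = solveℕ-∀
... | s , inj₂ refl = s , ℕ.*-cancelˡ-≡ (T s) r 8 (ℕ.suc-injective (trans (sym (odd-square s)) d²≡))

ψ-scale : ∀ {p r r′} → Prime p → 1 + 8 * r′ ≡ p * p * (1 + 8 * r) → ψ r′ ≡ ψ r
ψ-scale {p} {r} {r′} pp scale = ψ-cong divide multiply
  where
  instance _ = prime⇒nonZero pp

  multiply : ∃[ s ] T s ≡ r → ∃[ s ] T s ≡ r′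
  multiply (s , refl) = square⇒triangular (p * (1 + 2 * s)) r′ (begin
    p * (1 + 2 * s) * (p * (1 + 2 * s))       ≡⟨ regroup p (1 + 2 * s) ⟩
    p * p * ((1 + 2 * s) * (1 + 2 * s))       ≡⟨ cong (p * p *_) (odd-square s) ⟩
    p * p * (1 + 8 * T s)                     ≡⟨ scale ⟨
    1 + 8 * r′                                ∎)
    where
    open ≡-Reasoning
    regroup : ∀ p d → p * d * (p * d) ≡ p * p * (d * d)
    regroup = solveℕ-∀

  divide : ∃[ s ] T s ≡ r′ → ∃[ s ] T s ≡ r
  divide (s , refl) = from-divisor p∣odd
    where
    open ≡-Reasoning
    odd²≡ : (1 + 2 * s) * (1 + 2 * s) ≡ p * p * (1 + 8 * r)
    odd²≡ = trans (odd-square s) scale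
    p∣odd : p ∣ 1 + 2 * s
    p∣odd = [ id , id ]′ (euclidsLemma (1 + 2 * s) (1 + 2 * s) pp
      (ℕ.divides (p * (1 + 8 * r)) (trans odd²≡ (regroup p (1 + 8 * r)))))
      where
      regroup : ∀ p x → p * p * x ≡ p * x * p
      regroup = solveℕ-∀
    from-divisor : p ∣ 1 + 2 * s → ∃[ s ] T s ≡ r
    from-divisor (ℕ.divides d odd≡d*p) = square⇒triangular d r
      (ℕ.*-cancelˡ-≡ (d * d) (1 + 8 * r) (p * p) ⦃ ℕ.m*n≢0 p p ⦄ (begin
        p * p * (d * d)            ≡⟨ regroup p d ⟩
        d * p * (d * p)            ≡⟨ cong₂ _*_ odd≡d*p odd≡d*p ⟨
        (1 + 2 * s) * (1 + 2 * s)  ≡⟨ odd²≡ ⟩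
        p * p * (1 + 8 * r)        ∎))
      where
      regroup : ∀ p d → p * p * (d * d) ≡ d * p * (d * p)
      regroup = solveℕ-∀

-- Residues modulo 8

-- An odd i is invertible modulo 8; the eight residues are simply checked.
units-mod-8 : ∀ {i} → (i ≡ 3 ⊎ i ≡ 5 ⊎ i ≡ 7) → ∀ {t} → t < 8 → (t * i) % 8 ≡ i % 8 → t ≡ 1
units-mod-8 (inj₁ refl)        = from-yes (ℕ.allUpTo? (λ t → ((t * 3) % 8 ℕ.≟ 3) →-dec (t ℕ.≟ 1)) 8)
units-mod-8 (inj₂ (inj₁ refl)) = from-yes (ℕ.allUpTo? (λ t → ((t * 5) % 8 ℕ.≟ 5) →-dec (t ℕ.≟ 1)) 8)
units-mod-8 (inj₂ (inj₂ refl)) = from-yes (ℕ.allUpTo? (λ t → ((t * 7) % 8 ℕ.≟ 7) →-dec (t ℕ.≟ 1)) 8)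

residue<8 : ∀ {i} → (i ≡ 3 ⊎ i ≡ 5 ⊎ i ≡ 7) → i % 8 ≡ i
residue<8 (inj₁ refl)        = refl
residue<8 (inj₂ (inj₁ refl)) = refl
residue<8 (inj₂ (inj₂ refl)) = refl

-- Modulo 8, m p ≡ i ≡ p. The witness s is the fraction (8δ + i - p) / (8p) of N₂.
cofactor-mod-8 : ∀ {i p} δ m → (i ≡ 3 ⊎ i ≡ 5 ⊎ i ≡ 7) → p % 8 ≡ i → 8 * δ + i ≡ m * p →
                 ∃[ s ] m ≡ 1 + 8 * s
cofactor-mod-8 {i} {p} δ m i∈ p%8≡i mp≡ = m / 8 , trans (m≡m%n+[m/n]*n m 8)
  (cong₂ _+_ (units-mod-8 i∈ (m%n<n m 8) residue) (ℕ.*-comm (m / 8) 8))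
  where
  open ≡-Reasoning
  residue : (m % 8 * i) % 8 ≡ i % 8
  residue = begin
    (m % 8 * i) % 8       ≡⟨ cong (λ x → (m % 8 * x) % 8) p%8≡i ⟨
    (m % 8 * (p % 8)) % 8 ≡⟨ %-distribˡ-* m p 8 ⟨
    (m * p) % 8           ≡⟨ cong (_% 8) mp≡ ⟨
    (8 * δ + i) % 8       ≡⟨ cong (_% 8) (trans (ℕ.+-comm (8 * δ) i) (cong (_+_ i) (ℕ.*-comm 8 δ))) ⟩
    (i + δ * 8) % 8       ≡⟨ [m+kn]%n≡m%n i δ 8 ⟩
    i % 8                 ∎

odd-prime : ∀ {i p} → (i ≡ 3 ⊎ i ≡ 5 ⊎ i ≡ 7) → p % 8 ≡ i → ∃[ e ] p ≡ 1 + 2 * e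
odd-prime {i} {p} i∈ p%8≡i = half i∈
  where
  p≡ : p ≡ i + p / 8 * 8
  p≡ = trans (m≡m%n+[m/n]*n p 8) (cong (_+ p / 8 * 8) p%8≡i)
  regroup : ∀ x y → 1 + 2 * x + y * 8 ≡ 1 + 2 * (x + y * 4)
  regroup = solveℕ-∀
  half : (i ≡ 3 ⊎ i ≡ 5 ⊎ i ≡ 7) → ∃[ e ] p ≡ 1 + 2 * e
  half (inj₁ refl)        = 1 + p / 8 * 4 , trans p≡ (regroup 1 (p / 8))
  half (inj₂ (inj₁ refl)) = 2 + p / 8 * 4 , trans p≡ (regroup 2 (p / 8))
  half (inj₂ (inj₂ refl)) = 3 + p / 8 * 4 , trans p≡ (regroup 3 (p / 8))

-- The indices N₁ and N₂ as 3 (8r′ + 1) and 3 (8r + 1)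

-- Since 8δ + i = p + s (8p), the truncated subtraction and the division in `N₂` are both exact.
N₂-index : ∀ k i p δ n (pp : Prime p) s → 8 * δ + i ≡ (1 + 8 * s) * p →
           N₂ (suc k) i p δ n pp ≡ (1 + (p ^ k * n + s) * 2 * 2 * 2) * 3
N₂-index k i p δ n pp s 8δ+i≡ = trans
  (cong (λ x → 24 * (p ^ k * n + x) + 3) quotient≡s) (regroup (p ^ k * n) s)
  where
  instance
    _ = prime⇒nonZero pp
    _ = ℕ.m*n≢0 8 p
  regroup : ∀ x s → 24 * (x + s) + 3 ≡ (1 + (x + s) * 2 * 2 * 2) * 3
  regroup = solveℕ-∀
  expand : ∀ s p → (1 + 8 * s) * p ≡ p + s * (8 * p)
  expand = solveℕ-∀
  quotient≡s : (8 * δ + i ∸ p) / (8 * p) ≡ s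
  quotient≡s = trans
    (cong (_/ (8 * p)) (trans (cong (_∸ p) (trans 8δ+i≡ (expand s p))) (ℕ.m+n∸m≡n p (s * (8 * p)))))
    (m*n/n≡m s (8 * p))

module _ (k i p δ n s e : ℕ) (8δ+i≡ : 8 * δ + i ≡ (1 + 8 * s) * p) (p≡ : p ≡ 1 + 2 * e) where
  private
    r = p ^ k * n + s
    -- From p² = 1 + 8 T e, as p = 1 + 2e.
    r′ = T e + p * p * r

  p²[1+8r]≡ : 1 + 8 * r′ ≡ p * p * (1 + 8 * r)
  p²[1+8r]≡ = begin
    1 + 8 * (T e + p * p * r)        ≡⟨ regroup (T e) (p * p) r ⟩
    1 + 8 * T e + 8 * (p * p * r)    ≡⟨ cong (_+ 8 * (p * p * r)) (trans (cong₂ _*_ p≡ p≡) (odd-square e)) ⟨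
    p * p + 8 * (p * p * r)          ≡⟨ collect (p * p) r ⟩
    p * p * (1 + 8 * r)              ∎
    where
    open ≡-Reasoning
    regroup : ∀ t x r → 1 + 8 * (t + x * r) ≡ 1 + 8 * t + 8 * (x * r)
    regroup = solveℕ-∀
    collect : ∀ x r → x + 8 * (x * r) ≡ x * (1 + 8 * r)
    collect = solveℕ-∀

  -- The second factor p comes out of the bracket, both of whose parts, the power p^(k+1) and 8δ +
  -- i, are multiples of p.
  N₁-index : 3 * p * (8 * p ^ suc k * n + 8 * δ + i) ≡ (1 + r′ * 2 * 2 * 2) * 3
  N₁-index = begin
    3 * p * (8 * (p * p ^ k) * n + 8 * δ + i)   ≡⟨ cong (3 * p *_) (ℕ.+-assoc (8 * (p * p ^ k) * n) (8 * δ) i) ⟩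
    3 * p * (8 * (p * p ^ k) * n + (8 * δ + i)) ≡⟨ cong (λ x → 3 * p * (8 * (p * p ^ k) * n + x)) 8δ+i≡ ⟩
    3 * p * (8 * (p * p ^ k) * n + (1 + 8 * s) * p) ≡⟨ collect p (p ^ k) n s ⟩
    p * p * (1 + 8 * (p ^ k * n + s)) * 3       ≡⟨ cong (_* 3) p²[1+8r]≡ ⟨
    (1 + 8 * r′) * 3                            ≡⟨ regroup r′ ⟩
    (1 + r′ * 2 * 2 * 2) * 3                    ∎
    where
    open ≡-Reasoning
    collect : ∀ p x n s → 3 * p * (8 * (p * x) * n + (1 + 8 * s) * p) ≡ p * p * (1 + 8 * (x * n + s)) * 3
    collect = solveℕ-∀
    regroup : ∀ r → (1 + 8 * r) * 3 ≡ (1 + r * 2 * 2 * 2) * 3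
    regroup = solveℕ-∀

theorem3p6 : (k i p δ : ℕ) → 1 ≤ k → (i ≡ 3 ⊎ i ≡ 5 ⊎ i ≡ 7) →
    (pp : Prime p) → p % 8 ≡ i → p ∣ 8 * δ + i →
    (n : ℕ) →
    (+ 2) ∣ℤ (J6 (3 * p * (8 * p ^ k * n + 8 * δ + i)) - J6 (N₂ k i p δ n pp))
theorem3p6 (suc k) i p δ _ i∈ pp p%8≡i (ℕ.divides m 8δ+i≡mp) n
  with s , refl ← cofactor-mod-8 {i} {p} δ m i∈ p%8≡i 8δ+i≡mp
     | e , p≡ ← odd-prime {i} {p} i∈ p%8≡i =
  parity≡⇒2∣- (J6 (3 * p * (8 * p ^ suc k * n + 8 * δ + i))) (J6 (N₂ (suc k) i p δ n pp))
    (trans (J6-parity r′ (N₁-index k i p δ n s e 8δ+i≡mp p≡))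
    (trans (ψ-scale {p} {r} {r′} pp (p²[1+8r]≡ k i p δ n s e 8δ+i≡mp p≡))
           (sym (J6-parity r (N₂-index k i p δ n pp s 8δ+i≡mp)))))
  where
  r = p ^ k * n + s
  r′ = T e + p * p * r
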